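{- Let $P\ge 1$ be an integer, let $u:\mathbb{Z}/P\mathbb{Z}\to\mathbb{Z}$ be a function (a tile), and let $m\in\mathbb{Z}$, $m\ne 0$. Let $Q_u(x)$ and $\tilde d_u(x)$ be the polynomials defined in the context. 1) An $m$-multitiling $v$ of the group $\mathbb{Z}/P\mathbb{Z}$ with the tile $u$ exists if and only if $m\cdot\tilde d_u(1)$ is divisible by $Q_u(1)$. 2) If $m\cdot \tilde d_u(1)$ is divisible by $Q_u(1)$, $P=q^t$ for some prime $q$ and positive integer $t$, and, in addition, $0<m\le Q_u(1)$, then there exists an $m$-tiling $v$ of the group $\mathbb{Z}/P\mathbb{Z}$ with the tile $u$.
   Context: An $m$-multitiling of a finite abelian group $H$ with a tile $u:H\to\mathbb{Z}$ is a function $v:H\to\mathbb{Z}$ such that $\sum_{h\in H}u(g-h)v(h)=m$ for each $g\in H$. An $m$-tiling of $H$ with the tile $u$ is an $m$-multitiling $v$ with $v(h)\in\{0,1\}$ for each $h\in H$. For $H=\mathbb{Z}/P\mathbb{Z}$ put $Q_u(x)=\sum_{a=0}^{P-1}u(a)x^a$ and $$\tilde d_u(x)=\prod_{n:\; n\mid P,\ \Phi_n(x)\mid Q_u(x),\ n\text{ is a prime power}}\Phi_n(x),$$ where $\Phi_n$ is the $n$-th cyclotomic polynomial and a prime power means $p^j$ with $p$ prime and $j\ge1$ (so $1$ is not a prime power); an empty product is $1$. "$x$ is divisible by $y$" for integers means $x=yz$ for some integer $z$ (so only $0$ is divisible by $0$). -}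

module Defs where

open import Data.Bool.Base using (if_then_else_)
open import Data.Empty using (⊥-elim)
open import Data.Fin.Base using (Fin; toℕ)
open import Data.Integer.Base using (ℤ; -_; _+_; _*_; 0ℤ; 1ℤ; -1ℤ; ≢-nonZero)
open import Data.Integer.Divisibility.Signed using (divides) renaming (_∣?_ to _∣ℤ?_)
import Data.Integer.Properties as ℤ
open import Algebra.Properties.CommutativeMonoid.Sum ℤ.+-0-commutativeMonoid using (sum)
open import Data.List.Base using (List; []; _∷_; [_]; _++_; map; foldr; filter; length; replicate; tabulate; upTo)
import Data.Nat.Base as ℕ
open ℕ using (ℕ; zero; suc; _∸_; _^_; _≤_; _<_; z≤n; s≤s; NonZero)
open import Data.Nat.Divisibility using (_∣_; _∣?_)
open import Data.Nat.DivMod using (_mod_)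
open import Data.Nat.Primality using (Prime; prime?; prime⇒nonTrivial)
import Data.Nat.Properties as ℕ
open import Data.Product using (∃; ∃₂; _×_; _,_; proj₁; proj₂)
open import Data.Sum.Base using (_⊎_; inj₁; inj₂; [_,_]′)
open import Function.Base using (_∘_)
open import Relation.Binary.PropositionalEquality hiding ([_])
open import Relation.Nullary using (Dec; yes; no; does; ¬_)
open import Relation.Nullary.Decidable using (_×-dec_; map′)

-- a₀ ∷ a₁ ∷ … stands for a₀ + a₁x + ⋯.  Trailing zeros are allowed, so
-- equality of polynomials is _≈ᵖ_ below, not _≡_.
Poly : Set
Poly = List ℤ

coeff : Poly → ℕ → ℤ
coeff []      _       = 0ℤ
coeff (a ∷ _) zero    = a
coeff (_ ∷ p) (suc i) = coeff p i

infix 4 _≈ᵖ_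
_≈ᵖ_ : Poly → Poly → Set
p ≈ᵖ q = ∀ i → coeff p i ≡ coeff q i

infixl 6 _+ᵖ_
_+ᵖ_ : Poly → Poly → Poly
[]      +ᵖ q       = q
p       +ᵖ []      = p
(a ∷ p) +ᵖ (b ∷ q) = (a + b) ∷ (p +ᵖ q)

infixr 7 _·ᵖ_
_·ᵖ_ : ℤ → Poly → Poly
c ·ᵖ p = map (c *_) p

infixl 7 _*ᵖ_
_*ᵖ_ : Poly → Poly → Poly
[]      *ᵖ q = []
(a ∷ p) *ᵖ q = (a ·ᵖ q) +ᵖ (0ℤ ∷ p *ᵖ q)

1ᵖ : Poly
1ᵖ = [ 1ℤ ]

productᵖ : List Poly → Poly
productᵖ = foldr _*ᵖ_ 1ᵖ

eval : Poly → ℤ → ℤ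
eval p x = foldr (λ a s → a + x * s) 0ℤ p

infix 4 _∣ᵖ_
_∣ᵖ_ : Poly → Poly → Set
p ∣ᵖ q = ∃ λ r → r *ᵖ p ≈ᵖ q

hd : Poly → ℤ
hd p = coeff p 0

tl : Poly → Poly
tl []      = []
tl (_ ∷ p) = p

coeff-tl : ∀ p i → coeff (tl p) i ≡ coeff p (suc i)
coeff-tl []      _ = refl
coeff-tl (_ ∷ _) _ = refl

coeff-+ᵖ : ∀ p q i → coeff (p +ᵖ q) i ≡ coeff p i + coeff q i
coeff-+ᵖ []      q       i       = sym (ℤ.+-identityˡ _)
coeff-+ᵖ (a ∷ p) []      i       = sym (ℤ.+-identityʳ _)
coeff-+ᵖ (a ∷ p) (b ∷ q) zero    = refl
coeff-+ᵖ (a ∷ p) (b ∷ q) (suc i) = coeff-+ᵖ p q i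

coeff-·ᵖ : ∀ c p i → coeff (c ·ᵖ p) i ≡ c * coeff p i
coeff-·ᵖ c []      i       = sym (ℤ.*-zeroʳ c)
coeff-·ᵖ c (a ∷ p) zero    = refl
coeff-·ᵖ c (a ∷ p) (suc i) = coeff-·ᵖ c p i

coeff-*ᵖ-zero : ∀ r p → coeff (r *ᵖ p) 0 ≡ hd r * hd p
coeff-*ᵖ-zero []      p = refl
coeff-*ᵖ-zero (a ∷ r) p = begin
  coeff ((a ·ᵖ p) +ᵖ (0ℤ ∷ r *ᵖ p)) 0  ≡⟨ coeff-+ᵖ (a ·ᵖ p) _ 0 ⟩
  coeff (a ·ᵖ p) 0 + 0ℤ                ≡⟨ ℤ.+-identityʳ _ ⟩
  coeff (a ·ᵖ p) 0                     ≡⟨ coeff-·ᵖ a p 0 ⟩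
  a * hd p                             ∎
  where open ≡-Reasoning

coeff-*ᵖ-suc : ∀ r p i →
  coeff (r *ᵖ p) (suc i) ≡ hd r * coeff p (suc i) + coeff (tl r *ᵖ p) i
coeff-*ᵖ-suc []      p i = refl
coeff-*ᵖ-suc (a ∷ r) p i = begin
  coeff ((a ·ᵖ p) +ᵖ (0ℤ ∷ r *ᵖ p)) (suc i)     ≡⟨ coeff-+ᵖ (a ·ᵖ p) _ (suc i) ⟩
  coeff (a ·ᵖ p) (suc i) + coeff (r *ᵖ p) i     ≡⟨ cong (_+ _) (coeff-·ᵖ a p (suc i)) ⟩
  a * coeff p (suc i) + coeff (r *ᵖ p) i        ∎
  where open ≡-Reasoning

Zero : Poly → Set
Zero p = ∀ i → coeff p i ≡ 0ℤ

zero? : ∀ p → Dec (Zero p)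
zero? []      = yes λ _ → refl
zero? (a ∷ p) with a ℤ.≟ 0ℤ | zero? p
... | yes a≡0 | yes z = yes λ { zero → a≡0 ; (suc i) → z i }
... | yes _   | no ¬z = no λ z → ¬z (z ∘ suc)
... | no a≢0  | _     = no λ z → a≢0 (z 0)

tl-zero : ∀ r → Zero r → Zero (tl r)
tl-zero r z i = trans (coeff-tl r i) (z (suc i))

*ᵖ-zeroˡ : ∀ r p → Zero r → Zero (r *ᵖ p)
*ᵖ-zeroˡ r p z zero    = trans (coeff-*ᵖ-zero r p) (cong (_* hd p) (z 0))
*ᵖ-zeroˡ r p z (suc i) = trans (coeff-*ᵖ-suc r p i)
  (cong₂ (λ a b → a * coeff p (suc i) + b) (z 0) (*ᵖ-zeroˡ (tl r) p (tl-zero r z) i))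

coeff-*ᵖ-0∷ : ∀ r p i → coeff (r *ᵖ (0ℤ ∷ p)) (suc i) ≡ coeff (r *ᵖ p) i
coeff-*ᵖ-0∷ r p zero = begin
  coeff (r *ᵖ (0ℤ ∷ p)) 1                     ≡⟨ coeff-*ᵖ-suc r (0ℤ ∷ p) 0 ⟩
  hd r * hd p + coeff (tl r *ᵖ (0ℤ ∷ p)) 0    ≡⟨ cong ((hd r * hd p) +_) (coeff-*ᵖ-zero (tl r) (0ℤ ∷ p)) ⟩
  hd r * hd p + hd (tl r) * 0ℤ                ≡⟨ cong ((hd r * hd p) +_) (ℤ.*-zeroʳ (hd (tl r))) ⟩
  hd r * hd p + 0ℤ                            ≡⟨ ℤ.+-identityʳ _ ⟩
  hd r * hd p                                 ≡⟨ coeff-*ᵖ-zero r p ⟨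
  coeff (r *ᵖ p) 0                            ∎
  where open ≡-Reasoning
coeff-*ᵖ-0∷ []        p (suc i) = refl
coeff-*ᵖ-0∷ r@(_ ∷ r′) p (suc i) = begin
  coeff (r *ᵖ (0ℤ ∷ p)) (suc (suc i))                         ≡⟨ coeff-*ᵖ-suc r (0ℤ ∷ p) (suc i) ⟩
  hd r * coeff p (suc i) + coeff (r′ *ᵖ (0ℤ ∷ p)) (suc i)     ≡⟨ cong ((hd r * coeff p (suc i)) +_) (coeff-*ᵖ-0∷ r′ p i) ⟩
  hd r * coeff p (suc i) + coeff (r′ *ᵖ p) i                  ≡⟨ coeff-*ᵖ-suc r p i ⟨
  coeff (r *ᵖ p) (suc i)                                      ∎
  where open ≡-Reasoning

VanishesFrom : ℕ → Poly → Set
VanishesFrom n p = ∀ i → n ≤ i → coeff p i ≡ 0ℤ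

HasDegree : Poly → ℕ → Set
HasDegree p d = coeff p d ≢ 0ℤ × VanishesFrom (suc d) p

degree : ∀ p → Zero p ⊎ ∃ (HasDegree p)
degree []      = inj₁ λ _ → refl
degree (a ∷ p) with degree p
... | inj₂ (d , a≢0 , v) = inj₂ (suc d , a≢0 , λ { (suc i) (s≤s d<i) → v i d<i })
... | inj₁ z with a ℤ.≟ 0ℤ
...   | yes a≡0 = inj₁ λ { zero → a≡0 ; (suc i) → z i }
...   | no  a≢0 = inj₂ (0 , a≢0 , λ { (suc i) _ → z i })

coeff-*ᵖ-top : ∀ r p k d → VanishesFrom (suc k) r → VanishesFrom (suc d) p →
  coeff (r *ᵖ p) (k ℕ.+ d) ≡ coeff r k * coeff p d
coeff-*ᵖ-top r p zero zero vr vp = coeff-*ᵖ-zero r p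
coeff-*ᵖ-top r p zero (suc d) vr vp = begin
  coeff (r *ᵖ p) (suc d)                              ≡⟨ coeff-*ᵖ-suc r p d ⟩
  hd r * coeff p (suc d) + coeff (tl r *ᵖ p) d        ≡⟨ cong ((hd r * coeff p (suc d)) +_) (*ᵖ-zeroˡ (tl r) p tl≈0 d) ⟩
  hd r * coeff p (suc d) + 0ℤ                         ≡⟨ ℤ.+-identityʳ _ ⟩
  hd r * coeff p (suc d)                              ∎
  where
  open ≡-Reasoning
  tl≈0 : Zero (tl r)
  tl≈0 i = trans (coeff-tl r i) (vr (suc i) (s≤s z≤n))
coeff-*ᵖ-top r p (suc k) d vr vp = begin
  coeff (r *ᵖ p) (suc (k ℕ.+ d))                                    ≡⟨ coeff-*ᵖ-suc r p (k ℕ.+ d) ⟩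
  hd r * coeff p (suc (k ℕ.+ d)) + coeff (tl r *ᵖ p) (k ℕ.+ d)      ≡⟨ cong₂ (λ a b → hd r * a + b) (vp _ (s≤s (ℕ.m≤n+m d k)))
                                                                            (coeff-*ᵖ-top (tl r) p k d vtl vp) ⟩
  hd r * 0ℤ + coeff (tl r) k * coeff p d                            ≡⟨ cong₂ (λ a b → a + b * coeff p d) (ℤ.*-zeroʳ (hd r)) (coeff-tl r k) ⟩
  0ℤ + coeff r (suc k) * coeff p d                                  ≡⟨ ℤ.+-identityˡ _ ⟩
  coeff r (suc k) * coeff p d                                       ∎
  where
  open ≡-Reasoning
  vtl : VanishesFrom (suc k) (tl r)
  vtl i k<i = trans (coeff-tl r i) (vr (suc i) (s≤s k<i))

vanishesFrom-length : ∀ p → VanishesFrom (length p) p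
vanishesFrom-length []      i       _         = refl
vanishesFrom-length (a ∷ p) (suc i) (s≤s l≤i) = vanishesFrom-length p i l≤i

quotient-bound : ∀ p q r → ¬ Zero p → r *ᵖ p ≈ᵖ q → VanishesFrom (length q) r
quotient-bound p q r p≉0 rp≈q with degree p | degree r
... | inj₁ p≈0              | _                     = ⊥-elim (p≉0 p≈0)
... | inj₂ _                | inj₁ r≈0              = λ i _ → r≈0 i
... | inj₂ (d , pd≢0 , vp)  | inj₂ (k , rk≢0 , vr)  =
  λ i l≤i → vr i (ℕ.<-≤-trans (ℕ.≰⇒> k<l) l≤i)
  where
  k<l : ¬ (length q ≤ k)
  k<l l≤k = [ rk≢0 , pd≢0 ]′ (ℤ.i*j≡0⇒i≡0∨j≡0 (coeff r k)
    (trans (sym (coeff-*ᵖ-top r p k d vr vp))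
    (trans (rp≈q (k ℕ.+ d)) (vanishesFrom-length q _ (ℕ.≤-trans l≤k (ℕ.m≤m+n k d))))))

-- Long division starting from the constant term, possible when the
-- constant term c of the divisor is nonzero.
module _ (c : ℤ) (c≢0 : c ≢ 0ℤ) (p : Poly) where

  boundedQuotient? : ∀ n q → Dec (∃ λ r → VanishesFrom n r × r *ᵖ (c ∷ p) ≈ᵖ q)
  boundedQuotient? zero q with zero? q
  ... | yes q≈0 = yes ([] , (λ _ _ → refl) , λ i → sym (q≈0 i))
  ... | no  q≉0 = no λ { (r , v , e) →
    q≉0 λ i → trans (sym (e i)) (*ᵖ-zeroˡ r (c ∷ p) (λ j → v j z≤n) i) }
  boundedQuotient? (suc n) q with c ∣ℤ? hd q
  ... | no c∤q₀ = no λ { (r , _ , e) →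
    c∤q₀ (divides (hd r) (trans (sym (e 0)) (coeff-*ᵖ-zero r (c ∷ p)))) }
  ... | yes (divides a q₀≡ac) with boundedQuotient? n (tl q +ᵖ ((- a) ·ᵖ p))
  ...   | yes (r , v , e) = yes (a ∷ r , v′ , e′)
    where
    open ≡-Reasoning
    v′ : VanishesFrom (suc n) (a ∷ r)
    v′ (suc i) (s≤s n≤i) = v i n≤i
    e′ : (a ∷ r) *ᵖ (c ∷ p) ≈ᵖ q
    e′ zero    = trans (coeff-*ᵖ-zero (a ∷ r) (c ∷ p)) (sym q₀≡ac)
    e′ (suc i) = begin
      coeff ((a ∷ r) *ᵖ (c ∷ p)) (suc i)                   ≡⟨ coeff-*ᵖ-suc (a ∷ r) (c ∷ p) i ⟩
      a * coeff p i + coeff (r *ᵖ (c ∷ p)) i               ≡⟨ cong ((a * coeff p i) +_) (e i) ⟩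
      a * coeff p i + coeff (tl q +ᵖ ((- a) ·ᵖ p)) i       ≡⟨ cong ((a * coeff p i) +_) (coeff-+ᵖ (tl q) _ i) ⟩
      a * coeff p i + (coeff (tl q) i + coeff ((- a) ·ᵖ p) i)
        ≡⟨ cong₂ (λ x y → a * coeff p i + (x + y)) (coeff-tl q i)
             (trans (coeff-·ᵖ (- a) p i) (sym (ℤ.neg-distribˡ-* a (coeff p i)))) ⟩
      a * coeff p i + (coeff q (suc i) + - (a * coeff p i)) ≡⟨ cong ((a * coeff p i) +_) (ℤ.+-comm (coeff q (suc i)) _) ⟩
      a * coeff p i + (- (a * coeff p i) + coeff q (suc i)) ≡⟨ ℤ.+-assoc (a * coeff p i) _ _ ⟨
      a * coeff p i + - (a * coeff p i) + coeff q (suc i)   ≡⟨ cong (_+ coeff q (suc i)) (ℤ.+-inverseʳ (a * coeff p i)) ⟩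
      0ℤ + coeff q (suc i)                                  ≡⟨ ℤ.+-identityˡ _ ⟩
      coeff q (suc i)                                       ∎
  ...   | no ¬r = no λ { (r , v , e) → ¬r (tl r , v′ r v , e′ r e) }
    where
    open ≡-Reasoning
    v′ : ∀ r → VanishesFrom (suc n) r → VanishesFrom n (tl r)
    v′ r v i n≤i = trans (coeff-tl r i) (v (suc i) (s≤s n≤i))
    hd≡a : ∀ r → r *ᵖ (c ∷ p) ≈ᵖ q → hd r ≡ a
    hd≡a r e = ℤ.*-cancelʳ-≡ (hd r) a c {{≢-nonZero c≢0}}
      (trans (sym (coeff-*ᵖ-zero r (c ∷ p))) (trans (e 0) q₀≡ac))
    e′ : ∀ r → r *ᵖ (c ∷ p) ≈ᵖ q → tl r *ᵖ (c ∷ p) ≈ᵖ tl q +ᵖ ((- a) ·ᵖ p)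
    e′ r e i = begin
      t                                                   ≡⟨ ℤ.+-identityʳ t ⟨
      t + 0ℤ                                              ≡⟨ cong (t +_) (ℤ.+-inverseʳ s) ⟨
      t + (s + - s)                                       ≡⟨ ℤ.+-assoc t s (- s) ⟨
      t + s + - s                                         ≡⟨ cong (_+ - s) (ℤ.+-comm t s) ⟩
      s + t + - s                                         ≡⟨ cong (λ x → x * coeff p i + t + - s) (hd≡a r e) ⟨
      hd r * coeff p i + t + - s                          ≡⟨ cong (_+ - s) (coeff-*ᵖ-suc r (c ∷ p) i) ⟨
      coeff (r *ᵖ (c ∷ p)) (suc i) + - s                  ≡⟨ cong (_+ - s) (trans (e (suc i)) (sym (coeff-tl q i))) ⟩
      coeff (tl q) i + - s                                ≡⟨ cong (coeff (tl q) i +_)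
                                                               (trans (ℤ.neg-distribˡ-* a (coeff p i)) (sym (coeff-·ᵖ (- a) p i))) ⟩
      coeff (tl q) i + coeff ((- a) ·ᵖ p) i               ≡⟨ coeff-+ᵖ (tl q) _ i ⟨
      coeff (tl q +ᵖ ((- a) ·ᵖ p)) i                      ∎
      where
      t = coeff (tl r *ᵖ (c ∷ p)) i
      s = a * coeff p i

*ᵖ-[] : ∀ r → Zero (r *ᵖ [])
*ᵖ-[] []      _       = refl
*ᵖ-[] (_ ∷ r) zero    = refl
*ᵖ-[] (_ ∷ r) (suc i) = *ᵖ-[] r i

infix 4 _∣ᵖ?_
_∣ᵖ?_ : ∀ p q → Dec (p ∣ᵖ q)
[] ∣ᵖ? q = map′
  (λ q≈0 → [] , λ i → sym (q≈0 i))
  (λ { (r , e) i → trans (sym (e i)) (*ᵖ-[] r i) })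
  (zero? q)
(c ∷ p) ∣ᵖ? q with c ℤ.≟ 0ℤ
... | no c≢0 = map′
  (λ { (r , _ , e) → r , e })
  (λ { (r , e) → r , quotient-bound (c ∷ p) q r (λ z → c≢0 (z 0)) e , e })
  (boundedQuotient? c c≢0 p (length q) q)
... | yes refl = map′
  (λ { (q₀≡0 , r , e) → r , λ
    { zero    → trans (q₀≡ r) (sym q₀≡0)
    ; (suc i) → trans (coeff-*ᵖ-0∷ r p i) (trans (e i) (coeff-tl q i)) } })
  (λ { (r , e) → trans (sym (e 0)) (q₀≡ r) , r ,
    λ i → trans (sym (coeff-*ᵖ-0∷ r p i)) (trans (e (suc i)) (sym (coeff-tl q i))) })
  ((hd q ℤ.≟ 0ℤ) ×-dec (p ∣ᵖ? tl q))
  where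
  q₀≡ : ∀ r → coeff (r *ᵖ (0ℤ ∷ p)) 0 ≡ 0ℤ
  q₀≡ r = trans (coeff-*ᵖ-zero r (0ℤ ∷ p)) (ℤ.*-zeroʳ (hd r))

-- The quotient of q by p when p divides q; otherwise a junk value.
infixl 7 _/ᵖ_
_/ᵖ_ : Poly → Poly → Poly
q /ᵖ p with p ∣ᵖ? q
... | yes (r , _) = r
... | no  _       = []

x^[_]-1 : ℕ → Poly
x^[ n ]-1 = [ -1ℤ ] +ᵖ (replicate n 0ℤ ++ [ 1ℤ ])

-- For n ≥ 1, Φ is determined by x ^ n − 1 = ∏ { Φ d ∣ d divides n }, so that
-- Φ n is the (always exact) quotient of x ^ n − 1 by the product over the
-- proper divisors of n.  Φ 0 is a junk value.
mutual
  Φ : ℕ → Poly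
  Φ n = x^[ n ]-1 /ᵖ ∏Φ-below n n

  -- ∏ { Φ d ∣ d divides n and d < k }
  ∏Φ-below : ℕ → ℕ → Poly
  ∏Φ-below n zero    = 1ᵖ
  ∏Φ-below n (suc k) =
    if does (k ∣? n) then ∏Φ-below n k *ᵖ Φ k else ∏Φ-below n k

IsPrimePower : ℕ → Set
IsPrimePower n = ∃₂ λ p j → Prime p × 1 ≤ j × n ≡ p ^ j

n<m^n : ∀ m n → 1 < m → n < m ^ n
n<m^n m zero    1<m = s≤s z≤n
n<m^n m (suc n) 1<m = ℕ.≤-<-trans (n<m^n m n 1<m) (ℕ.^-monoʳ-< m 1<m (ℕ.n<1+n n))

isPrimePower? : ∀ n → Dec (IsPrimePower n)
isPrimePower? n = map′
  (λ { (p , _ , j , _ , w) → p , j , w })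
  (λ { (p , j , w) → p , s≤s (p≤n p j w) , j , s≤s (j≤n p j w) , w })
  (ℕ.anyUpTo? (λ p → ℕ.anyUpTo? (λ j →
    prime? p ×-dec (1 ℕ.≤? j) ×-dec (n ℕ.≟ p ^ j)) (suc n)) (suc n))
  where
  1<p : ∀ {p} → Prime p → 1 < p
  1<p {p} pr = ℕ.nonTrivial⇒n>1 p {{prime⇒nonTrivial pr}}
  p≤n : ∀ p j → Prime p × 1 ≤ j × n ≡ p ^ j → p ≤ n
  p≤n p j (pr , 1≤j , refl) =
    subst (_≤ p ^ j) (ℕ.*-identityʳ p) (ℕ.^-monoʳ-≤ p {{ℕ.>-nonZero (ℕ.<-trans (s≤s z≤n) (1<p pr))}} 1≤j)
  j≤n : ∀ p j → Prime p × 1 ≤ j × n ≡ p ^ j → j ≤ n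
  j≤n p j (pr , _ , refl) = ℕ.<⇒≤ (n<m^n p j (1<p pr))

-- Fin P stands for the residues 0, …, P − 1 of ℤ/Pℤ, with subtraction _⊖_.
module _ {P : ℕ} .{{_ : NonZero P}} where

  infixl 6 _⊖_
  _⊖_ : Fin P → Fin P → Fin P
  g ⊖ h = (toℕ g ℕ.+ (P ∸ toℕ h)) mod P

  IsMultitiling : (u : Fin P → ℤ) (m : ℤ) (v : Fin P → ℤ) → Set
  IsMultitiling u m v = ∀ g → sum (λ h → u (g ⊖ h) * v h) ≡ m

  IsTiling : (u : Fin P → ℤ) (m : ℤ) (v : Fin P → ℤ) → Set
  IsTiling u m v = IsMultitiling u m v × (∀ h → v h ≡ 0ℤ ⊎ v h ≡ 1ℤ)

module _ {P : ℕ} (u : Fin P → ℤ) where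

  Q : Poly
  Q = tabulate u

  d̃-index? : ∀ n → Dec (n ∣ P × Φ n ∣ᵖ Q × IsPrimePower n)
  d̃-index? n = (n ∣? P) ×-dec (Φ n ∣ᵖ? Q) ×-dec isPrimePower? n

  d̃ : Poly
  d̃ = productᵖ (map Φ (filter d̃-index? (upTo (suc P))))

{-# OPTIONS --safe #-}
module Submission where

open import Defs
open import Algebra.Bundles using (CommutativeRing)
import Algebra.Properties.CommutativeSemigroup
open import Algebra.Consequences.Setoid using (comm∧distrʳ⇒distr; comm∧idˡ⇒id; comm∧invˡ⇒inv)
open import Data.Bool.Base using (if_then_else_)
open import Data.Empty using (⊥; ⊥-elim)
open import Data.Fin.Base using (Fin; toℕ; fromℕ; fromℕ<; inject₁) renaming (zero to fzero; suc to fsuc)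
import Data.Fin.Properties as Fin
open import Data.Integer.Base as ℤ using (ℤ; +_; -_; _+_; _*_; _≤_; _<_; 0ℤ; 1ℤ; -1ℤ; ∣_∣; +≤+)
open import Data.Integer.Divisibility.Signed as ℤ∣ using (_∣_)
import Data.Integer.Properties as ℤ
import Data.Integer.Tactic.RingSolver as ℤSolver
open import Data.List.Base using (List; []; _∷_; [_]; _++_; map; filter; replicate; tabulate; upTo; applyUpTo; applyDownFrom)
open import Data.List.Membership.Propositional using (_∈_)
open import Data.List.Membership.Propositional.Properties using (∈-filter⁺; ∈-filter⁻; ∈-upTo⁺; ∈-applyDownFrom⁺; ∈-applyDownFrom⁻)
open import Data.List.Membership.Propositional.Properties.WithK using (unique∧set⇒bag)
open import Data.List.Properties using (filter-accept; filter-reject; tabulate-cong)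
open import Data.List.Relation.Binary.BagAndSetEquality using (∼bag⇒↭)
open import Data.List.Relation.Binary.Permutation.Propositional as ↭ using (_↭_)
open import Data.List.Relation.Unary.All as All using (All; []; _∷_)
open import Data.List.Relation.Unary.All.Properties using (all-filter)
open import Data.List.Relation.Unary.AllPairs using (AllPairs; []; _∷_)
import Data.List.Relation.Unary.AllPairs.Properties as AllPairs
open import Data.List.Relation.Unary.Any using (here; there)
open import Data.List.Relation.Unary.Unique.Propositional using (Unique)
import Data.List.Relation.Unary.Unique.Propositional.Properties as Unique
open import Data.Nat.Base as ℕ using (ℕ; zero; suc; z≤n; s≤s; NonZero; _^_; _∸_; _%_; _!)
open import Data.Nat.Combinatorics using (_C_; nCk≡n!/k![n-k]!; k![n∸k]!∣n!; nCn≡1)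
open import Data.Nat.Coprimality using (Coprime; coprime-divisor)
open import Data.Nat.Divisibility as ℕ∣ using (_∤_; divides; divides-refl; _∣?_; ∣⇒≤; ∣1⇒≡1; 0∣⇒≡0; 1∣_; ∣-trans; *-monoʳ-∣; *-cancelˡ-∣; *-cancelʳ-∣; m∣m*n; n∣m*n)
open import Data.Nat.DivMod using (_mod_; m/n*n≡m; [m+n]%n≡m%n; [m+kn]%n≡m%n; m<n⇒m%n≡m; m%n<n)
open import Data.Nat.Induction using (<-rec)
open import Data.Nat.ListAction using (product)
open import Data.Nat.Primality using (Prime; euclidsLemma; prime⇒irreducible; prime⇒nonTrivial; prime⇒nonZero; ¬prime[1])
open import Data.Nat.Primality.Factorisation using (factorise)
import Data.Nat.Properties as ℕ
import Data.Nat.Tactic.RingSolver as ℕSolver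
open import Data.Product using (∃; ∃₂; _×_; _,_; proj₁; proj₂)
open import Data.Sum.Base as Sum using (_⊎_; inj₁; inj₂; [_,_]′)
open import Function.Base using (_∘_; const; id)
open import Function.Bundles using (_⇔_; mk⇔; Equivalence)
open import Level using (0ℓ)
open import Relation.Binary.Bundles using (Setoid)
open import Relation.Binary.PropositionalEquality hiding ([_])
import Relation.Binary.Reasoning.Setoid as SetoidReasoning
open import Relation.Nullary using (¬_; Dec; yes; no; ¬?)
open import Relation.Nullary.Decidable using (_×-dec_; map′; dec-true; dec-false; dec⇒maybe)
open import Relation.Unary using (Decidable)
open import Tactic.RingSolver using (solve-∀)
open import Tactic.RingSolver.Core.AlmostCommutativeRing using (AlmostCommutativeRing; fromCommutativeRing)
open import Algebra.Properties.CommutativeMonoid.Sum ℤ.+-0-commutativeMonoid using (sum; sum-cong-≗)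

-- Only the cyclotomic polynomials Φₙ with n a prime power matter.  Let
-- N = 1 + x + ⋯ + x ^ (P − 1), let D = d̃ and let E be the product of the Φₙ
-- over the prime powers n ∣ P with Φₙ ∤ Q.  These Φₙ are pairwise distinct
-- primes of ℤ[x] dividing N, so N = M D E for some M; as Φₙ(1) = p for
-- n = p ^ j, both N(1) and D(1) E(1) are equal to P, whence M(1) = 1.
--
-- A function v is an m-multitiling iff Q_u Q_v ≡ m N modulo x ^ P − 1.  Then
-- each prime Φₙ occurring in E divides Q_v, so that Q_v = W E, and evaluating
-- at 1 gives Q_u(1) W(1) = m D(1).  Conversely, if Q_u(1) c = m D(1), then
-- c M E, reduced modulo x ^ P − 1, is an m-multitiling.  If P is a prime power,
-- then M = 1 and 0 ≤ c ≤ D(1); choosing K with coefficients between 0 and those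
-- of D and with K(1) = c, the product K E has coefficients between 0 and those
-- of D E = N, that is, in {0 , 1}.

-- The ring ℤ[x]

-- The identity (x - 1) N = x ^ P - 1 ties the congruence to values at 1: modulo x ^ P - 1 the
-- product s N depends only on s(1), so v is an m-multitiling iff Q_u Q_v = s N for some s with s(1)
-- = m. This is why c M E works: with Q_u = R D the product is c R N, and c R(1) D(1) = c Q_u(1) = m
-- D(1) forces c R(1) = m. The only values cancelled in the first claim are D(1) and E(1), which are
-- nonzero because D(1) E(1) = P. The main obstacle is the primality of Φₙ. It serves twice: to push
-- a divisor of Q_u Q_v into Q_v, and to combine distinct divisors into their product. It is proved
-- inside ℤ[x], without rational coefficients or unique factorisation: since Φₙ(1) = p, the element
-- x - 1 acts modulo Φₙ like a uniformiser at p, and divisibility is detected by p-adic size.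

infix 8 -ᵖ_
-ᵖ_ : Poly → Poly
-ᵖ_ = map -_

coeff--ᵖ : ∀ p i → coeff (-ᵖ p) i ≡ - coeff p i
coeff--ᵖ []      i       = refl
coeff--ᵖ (a ∷ p) zero    = refl
coeff--ᵖ (a ∷ p) (suc i) = coeff--ᵖ p i

-- The induction is on the index and not on the lists, because equal polynomials may be lists of
-- different lengths.
*ᵖ-congˡ : ∀ r r′ p → r ≈ᵖ r′ → r *ᵖ p ≈ᵖ r′ *ᵖ p
*ᵖ-congˡ r r′ p e zero = begin
  coeff (r *ᵖ p) 0   ≡⟨ coeff-*ᵖ-zero r p ⟩
  hd r * hd p        ≡⟨ cong (_* hd p) (e 0) ⟩
  hd r′ * hd p       ≡⟨ coeff-*ᵖ-zero r′ p ⟨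
  coeff (r′ *ᵖ p) 0  ∎
  where open ≡-Reasoning
*ᵖ-congˡ r r′ p e (suc i) = begin
  coeff (r *ᵖ p) (suc i)
    ≡⟨ coeff-*ᵖ-suc r p i ⟩
  hd r * coeff p (suc i) + coeff (tl r *ᵖ p) i
    ≡⟨ cong₂ (λ a b → a * coeff p (suc i) + b) (e 0) (*ᵖ-congˡ (tl r) (tl r′) p tl≈ i) ⟩
  hd r′ * coeff p (suc i) + coeff (tl r′ *ᵖ p) i
    ≡⟨ coeff-*ᵖ-suc r′ p i ⟨
  coeff (r′ *ᵖ p) (suc i)
    ∎
  where
  open ≡-Reasoning
  tl≈ : tl r ≈ᵖ tl r′
  tl≈ j = trans (coeff-tl r j) (trans (e (suc j)) (sym (coeff-tl r′ j)))

-- Mirror image of `coeff-*ᵖ-suc`, with the constant term split off from the right factor; comparing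
-- the two yields commutativity.
coeff-*ᵖ-suc′ : ∀ r p i →
  coeff (r *ᵖ p) (suc i) ≡ coeff r (suc i) * hd p + coeff (r *ᵖ tl p) i
coeff-*ᵖ-suc′ r p zero = begin
  coeff (r *ᵖ p) 1
    ≡⟨ coeff-*ᵖ-suc r p 0 ⟩
  hd r * coeff p 1 + coeff (tl r *ᵖ p) 0
    ≡⟨ cong₂ (λ a b → hd r * a + b) (sym (coeff-tl p 0)) (coeff-*ᵖ-zero (tl r) p) ⟩
  hd r * hd (tl p) + hd (tl r) * hd p
    ≡⟨ ℤ.+-comm (hd r * hd (tl p)) _ ⟩
  hd (tl r) * hd p + hd r * hd (tl p)
    ≡⟨ cong₂ (λ a b → a * hd p + b) (coeff-tl r 0) (sym (coeff-*ᵖ-zero r (tl p))) ⟩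
  coeff r 1 * hd p + coeff (r *ᵖ tl p) 0
    ∎
  where open ≡-Reasoning
coeff-*ᵖ-suc′ r p (suc i) = begin
  coeff (r *ᵖ p) (suc (suc i))
    ≡⟨ coeff-*ᵖ-suc r p (suc i) ⟩
  hd r * coeff p (suc (suc i)) + coeff (tl r *ᵖ p) (suc i)
    ≡⟨ cong₂ (λ a b → hd r * a + b) (sym (coeff-tl p (suc i))) (coeff-*ᵖ-suc′ (tl r) p i) ⟩
  hd r * coeff (tl p) (suc i) + (coeff (tl r) (suc i) * hd p + coeff (tl r *ᵖ tl p) i)
    ≡⟨ swap (hd r * coeff (tl p) (suc i)) (coeff (tl r) (suc i) * hd p) _ ⟩
  coeff (tl r) (suc i) * hd p + (hd r * coeff (tl p) (suc i) + coeff (tl r *ᵖ tl p) i)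
    ≡⟨ cong₂ (λ a b → a * hd p + b) (coeff-tl r (suc i)) (sym (coeff-*ᵖ-suc r (tl p) i)) ⟩
  coeff r (suc (suc i)) * hd p + coeff (r *ᵖ tl p) (suc i)
    ∎
  where
  open ≡-Reasoning
  swap : ∀ a b c → a + (b + c) ≡ b + (a + c)
  swap = ℤSolver.solve-∀

*ᵖ-comm : ∀ r p → r *ᵖ p ≈ᵖ p *ᵖ r
*ᵖ-comm r p zero = begin
  coeff (r *ᵖ p) 0  ≡⟨ coeff-*ᵖ-zero r p ⟩
  hd r * hd p       ≡⟨ ℤ.*-comm (hd r) (hd p) ⟩
  hd p * hd r       ≡⟨ coeff-*ᵖ-zero p r ⟨
  coeff (p *ᵖ r) 0  ∎
  where open ≡-Reasoning
*ᵖ-comm r p (suc i) = begin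
  coeff (r *ᵖ p) (suc i)
    ≡⟨ coeff-*ᵖ-suc r p i ⟩
  hd r * coeff p (suc i) + coeff (tl r *ᵖ p) i
    ≡⟨ cong₂ _+_ (ℤ.*-comm (hd r) _) (*ᵖ-comm (tl r) p i) ⟩
  coeff p (suc i) * hd r + coeff (p *ᵖ tl r) i
    ≡⟨ coeff-*ᵖ-suc′ p r i ⟨
  coeff (p *ᵖ r) (suc i)
    ∎
  where open ≡-Reasoning

*ᵖ-distribʳ-+ᵖ : ∀ r p q → (p +ᵖ q) *ᵖ r ≈ᵖ p *ᵖ r +ᵖ q *ᵖ r
*ᵖ-distribʳ-+ᵖ r p q zero = begin
  coeff ((p +ᵖ q) *ᵖ r) 0                ≡⟨ coeff-*ᵖ-zero (p +ᵖ q) r ⟩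
  hd (p +ᵖ q) * hd r                     ≡⟨ cong (_* hd r) (coeff-+ᵖ p q 0) ⟩
  (hd p + hd q) * hd r                   ≡⟨ ℤ.*-distribʳ-+ (hd r) (hd p) (hd q) ⟩
  hd p * hd r + hd q * hd r              ≡⟨ cong₂ _+_ (coeff-*ᵖ-zero p r) (coeff-*ᵖ-zero q r) ⟨
  coeff (p *ᵖ r) 0 + coeff (q *ᵖ r) 0    ≡⟨ coeff-+ᵖ (p *ᵖ r) (q *ᵖ r) 0 ⟨
  coeff (p *ᵖ r +ᵖ q *ᵖ r) 0             ∎
  where open ≡-Reasoning
*ᵖ-distribʳ-+ᵖ r p q (suc i) = begin
  coeff ((p +ᵖ q) *ᵖ r) (suc i)
    ≡⟨ coeff-*ᵖ-suc (p +ᵖ q) r i ⟩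
  hd (p +ᵖ q) * r′ + coeff (tl (p +ᵖ q) *ᵖ r) i
    ≡⟨ cong₂ (λ a b → a * r′ + b) (coeff-+ᵖ p q 0) (*ᵖ-congˡ (tl (p +ᵖ q)) (tl p +ᵖ tl q) r tl≈ i) ⟩
  (hd p + hd q) * r′ + coeff ((tl p +ᵖ tl q) *ᵖ r) i
    ≡⟨ cong (λ z → ((hd p + hd q) * r′) + z)
         (trans (*ᵖ-distribʳ-+ᵖ r (tl p) (tl q) i) (coeff-+ᵖ (tl p *ᵖ r) (tl q *ᵖ r) i)) ⟩
  (hd p + hd q) * r′ + (coeff (tl p *ᵖ r) i + coeff (tl q *ᵖ r) i)
    ≡⟨ regroup (hd p) (hd q) r′ (coeff (tl p *ᵖ r) i) (coeff (tl q *ᵖ r) i) ⟩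
  (hd p * r′ + coeff (tl p *ᵖ r) i) + (hd q * r′ + coeff (tl q *ᵖ r) i)
    ≡⟨ cong₂ _+_ (coeff-*ᵖ-suc p r i) (coeff-*ᵖ-suc q r i) ⟨
  coeff (p *ᵖ r) (suc i) + coeff (q *ᵖ r) (suc i)
    ≡⟨ coeff-+ᵖ (p *ᵖ r) (q *ᵖ r) (suc i) ⟨
  coeff (p *ᵖ r +ᵖ q *ᵖ r) (suc i)
    ∎
  where
  open ≡-Reasoning
  r′ = coeff r (suc i)
  tl≈ : tl (p +ᵖ q) ≈ᵖ tl p +ᵖ tl q
  tl≈ j = begin
    coeff (tl (p +ᵖ q)) j              ≡⟨ coeff-tl (p +ᵖ q) j ⟩
    coeff (p +ᵖ q) (suc j)             ≡⟨ coeff-+ᵖ p q (suc j) ⟩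
    coeff p (suc j) + coeff q (suc j)  ≡⟨ cong₂ _+_ (coeff-tl p j) (coeff-tl q j) ⟨
    coeff (tl p) j + coeff (tl q) j    ≡⟨ coeff-+ᵖ (tl p) (tl q) j ⟨
    coeff (tl p +ᵖ tl q) j             ∎
  regroup : ∀ a b c d e → (a + b) * c + (d + e) ≡ (a * c + d) + (b * c + e)
  regroup = ℤSolver.solve-∀

·ᵖ-*ᵖ : ∀ c p q → (c ·ᵖ p) *ᵖ q ≈ᵖ c ·ᵖ (p *ᵖ q)
·ᵖ-*ᵖ c []      q i       = refl
·ᵖ-*ᵖ c (a ∷ p) q zero    = begin
  coeff (((c * a) ∷ (c ·ᵖ p)) *ᵖ q) 0  ≡⟨ coeff-*ᵖ-zero (c ·ᵖ (a ∷ p)) q ⟩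
  c * a * hd q                         ≡⟨ ℤ.*-assoc c a (hd q) ⟩
  c * (a * hd q)                       ≡⟨ cong (c *_) (coeff-*ᵖ-zero (a ∷ p) q) ⟨
  c * coeff ((a ∷ p) *ᵖ q) 0           ≡⟨ coeff-·ᵖ c ((a ∷ p) *ᵖ q) 0 ⟨
  coeff (c ·ᵖ ((a ∷ p) *ᵖ q)) 0        ∎
  where open ≡-Reasoning
·ᵖ-*ᵖ c (a ∷ p) q (suc i) = begin
  coeff ((c ·ᵖ (a ∷ p)) *ᵖ q) (suc i)           ≡⟨ coeff-*ᵖ-suc (c ·ᵖ (a ∷ p)) q i ⟩
  c * a * q′ + coeff ((c ·ᵖ p) *ᵖ q) i          ≡⟨ cong (λ z → (c * a * q′) + z) (trans (·ᵖ-*ᵖ c p q i) (coeff-·ᵖ c (p *ᵖ q) i)) ⟩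
  c * a * q′ + c * coeff (p *ᵖ q) i             ≡⟨ factor c a q′ (coeff (p *ᵖ q) i) ⟩
  c * (a * q′ + coeff (p *ᵖ q) i)               ≡⟨ cong (c *_) (coeff-*ᵖ-suc (a ∷ p) q i) ⟨
  c * coeff ((a ∷ p) *ᵖ q) (suc i)              ≡⟨ coeff-·ᵖ c ((a ∷ p) *ᵖ q) (suc i) ⟨
  coeff (c ·ᵖ ((a ∷ p) *ᵖ q)) (suc i)           ∎
  where
  open ≡-Reasoning
  q′ = coeff q (suc i)
  factor : ∀ c a b d → c * a * b + c * d ≡ c * (a * b + d)
  factor = ℤSolver.solve-∀

0∷-*ᵖ : ∀ p q → (0ℤ ∷ p) *ᵖ q ≈ᵖ 0ℤ ∷ p *ᵖ q
0∷-*ᵖ p q zero    = trans (coeff-*ᵖ-zero (0ℤ ∷ p) q) (ℤ.*-zeroˡ (hd q))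
0∷-*ᵖ p q (suc i) = trans (coeff-*ᵖ-suc (0ℤ ∷ p) q i)
  (trans (cong (_+ coeff (p *ᵖ q) i) (ℤ.*-zeroˡ (coeff q (suc i)))) (ℤ.+-identityˡ _))

+ᵖ-cong : ∀ {p p′ q q′} → p ≈ᵖ p′ → q ≈ᵖ q′ → p +ᵖ q ≈ᵖ p′ +ᵖ q′
+ᵖ-cong {p} {p′} {q} {q′} e f i =
  trans (coeff-+ᵖ p q i) (trans (cong₂ _+_ (e i) (f i)) (sym (coeff-+ᵖ p′ q′ i)))

*ᵖ-assoc : ∀ p q r → (p *ᵖ q) *ᵖ r ≈ᵖ p *ᵖ (q *ᵖ r)
*ᵖ-assoc []      q r i = refl
*ᵖ-assoc (a ∷ p) q r i = begin
  coeff ((a ·ᵖ q +ᵖ (0ℤ ∷ p *ᵖ q)) *ᵖ r) i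
    ≡⟨ *ᵖ-distribʳ-+ᵖ r (a ·ᵖ q) (0ℤ ∷ p *ᵖ q) i ⟩
  coeff ((a ·ᵖ q) *ᵖ r +ᵖ (0ℤ ∷ p *ᵖ q) *ᵖ r) i
    ≡⟨ +ᵖ-cong {(a ·ᵖ q) *ᵖ r} {a ·ᵖ (q *ᵖ r)} {(0ℤ ∷ p *ᵖ q) *ᵖ r} {0ℤ ∷ p *ᵖ (q *ᵖ r)} (·ᵖ-*ᵖ a q r) shift i ⟩
  coeff (a ·ᵖ (q *ᵖ r) +ᵖ (0ℤ ∷ p *ᵖ (q *ᵖ r))) i
    ∎
  where
  open ≡-Reasoning
  shift : (0ℤ ∷ p *ᵖ q) *ᵖ r ≈ᵖ 0ℤ ∷ p *ᵖ (q *ᵖ r)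
  shift zero    = 0∷-*ᵖ (p *ᵖ q) r zero
  shift (suc j) = trans (0∷-*ᵖ (p *ᵖ q) r (suc j)) (*ᵖ-assoc p q r j)

*ᵖ-identityˡ : ∀ p → 1ᵖ *ᵖ p ≈ᵖ p
*ᵖ-identityˡ p zero    = trans (coeff-*ᵖ-zero 1ᵖ p) (ℤ.*-identityˡ (hd p))
*ᵖ-identityˡ p (suc i) = trans (coeff-*ᵖ-suc 1ᵖ p i)
  (trans (ℤ.+-identityʳ _) (ℤ.*-identityˡ (coeff p (suc i))))

-- Unlike _≈ᵖ_, which unfolds to a family of equations, the record lets Agda
-- infer the polynomials from a proof.
infix 4 _≋_
record _≋_ (p q : Poly) : Set where
  constructor mk≋
  field at : p ≈ᵖ q
open _≋_ public

≋-setoid : Setoid 0ℓ 0ℓ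
≋-setoid = record
  { Carrier = Poly
  ; _≈_ = _≋_
  ; isEquivalence = record
    { refl  = mk≋ λ i → refl
    ; sym   = λ (mk≋ e) → mk≋ (sym ∘ e)
    ; trans = λ (mk≋ e) (mk≋ f) → mk≋ λ i → trans (e i) (f i)
    }
  }

polyRing : CommutativeRing 0ℓ 0ℓ
polyRing = record
  { Carrier = Poly
  ; _≈_ = _≋_
  ; _+_ = _+ᵖ_
  ; _*_ = _*ᵖ_
  ; -_ = -ᵖ_
  ; 0# = []
  ; 1# = 1ᵖ
  ; isCommutativeRing = record
    { isRing = record
      { +-isAbelianGroup = record
        { isGroup = record
          { isMonoid = record
            { isSemigroup = record
              { isMagma = record { isEquivalence = Setoid.isEquivalence ≋-setoid ; ∙-cong = +-cong }
              ; assoc = λ p q r → mk≋ λ i → +-assoc p q r i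
              }
            ; identity = comm∧idˡ⇒id ≋-setoid +-comm λ p → mk≋ λ i → refl
            }
          ; inverse = comm∧invˡ⇒inv ≋-setoid +-comm λ p → mk≋ λ i → trans (coeff-+ᵖ (-ᵖ p) p i)
              (trans (cong (_+ coeff p i) (coeff--ᵖ p i)) (ℤ.+-inverseˡ (coeff p i)))
          ; ⁻¹-cong = λ {p} {q} (mk≋ e) → mk≋ λ i →
              trans (coeff--ᵖ p i) (trans (cong -_ (e i)) (sym (coeff--ᵖ q i)))
          }
        ; comm = +-comm
        }
      ; *-cong = *-cong
      ; *-assoc = λ p q r → mk≋ (*ᵖ-assoc p q r)
      ; *-identity = comm∧idˡ⇒id ≋-setoid *-comm λ p → mk≋ (*ᵖ-identityˡ p)
      ; distrib = comm∧distrʳ⇒distr ≋-setoid +-cong *-comm λ r p q → mk≋ (*ᵖ-distribʳ-+ᵖ r p q)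
      }
    ; *-comm = *-comm
    }
  }
  where
  +-cong : ∀ {p p′ q q′} → p ≋ p′ → q ≋ q′ → p +ᵖ q ≋ p′ +ᵖ q′
  +-cong {p} {p′} {q} {q′} (mk≋ e) (mk≋ f) = mk≋ (+ᵖ-cong {p} {p′} {q} {q′} e f)
  +-comm : ∀ p q → p +ᵖ q ≋ q +ᵖ p
  +-comm p q = mk≋ λ i → trans (coeff-+ᵖ p q i)
    (trans (ℤ.+-comm (coeff p i) (coeff q i)) (sym (coeff-+ᵖ q p i)))
  *-comm : ∀ p q → p *ᵖ q ≋ q *ᵖ p
  *-comm p q = mk≋ (*ᵖ-comm p q)
  *-cong : ∀ {p p′ q q′} → p ≋ p′ → q ≋ q′ → p *ᵖ q ≋ p′ *ᵖ q′
  *-cong {p} {p′} {q} {q′} (mk≋ e) (mk≋ f) = mk≋ λ i → begin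
    coeff (p *ᵖ q) i    ≡⟨ *ᵖ-congˡ p p′ q e i ⟩
    coeff (p′ *ᵖ q) i   ≡⟨ *ᵖ-comm p′ q i ⟩
    coeff (q *ᵖ p′) i   ≡⟨ *ᵖ-congˡ q q′ p′ f i ⟩
    coeff (q′ *ᵖ p′) i  ≡⟨ *ᵖ-comm q′ p′ i ⟩
    coeff (p′ *ᵖ q′) i  ∎
    where open ≡-Reasoning
  +-assoc : ∀ p q r → (p +ᵖ q) +ᵖ r ≈ᵖ p +ᵖ (q +ᵖ r)
  +-assoc p q r i = begin
    coeff ((p +ᵖ q) +ᵖ r) i              ≡⟨ coeff-+ᵖ (p +ᵖ q) r i ⟩
    coeff (p +ᵖ q) i + coeff r i         ≡⟨ cong (_+ coeff r i) (coeff-+ᵖ p q i) ⟩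
    coeff p i + coeff q i + coeff r i    ≡⟨ ℤ.+-assoc (coeff p i) (coeff q i) (coeff r i) ⟩
    coeff p i + (coeff q i + coeff r i)  ≡⟨ cong (λ z → coeff p i + z) (coeff-+ᵖ q r i) ⟨
    coeff p i + coeff (q +ᵖ r) i         ≡⟨ coeff-+ᵖ p (q +ᵖ r) i ⟨
    coeff (p +ᵖ (q +ᵖ r)) i              ∎
    where open ≡-Reasoning

polySolverRing : AlmostCommutativeRing 0ℓ 0ℓ
polySolverRing = fromCommutativeRing polyRing λ p →
  dec⇒maybe (map′ (λ z → mk≋ (sym ∘ z)) (λ e → sym ∘ at e) (zero? p))

module R = CommutativeRing polyRing
module ≋-Reasoning = SetoidReasoning ≋-setoid
open import Algebra.Properties.Semiring.Exp R.semiring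
  using () renaming (_^_ to _^ᵖ_; ^-assocʳ to ^ᵖ-assocʳ; ^-congˡ to ^ᵖ-congˡ)
open import Algebra.Properties.Semiring.Sum R.semiring
  using (sum-init-last) renaming (sum to sumᵖ; sum-cong-≋ to sumᵖ-cong; *-distribˡ-sum to *ᵖ-distribˡ-sum)
open import Algebra.Properties.Monoid.Mult R.+-monoid using () renaming (_×_ to _×ᵖ_)
import Algebra.Properties.CommutativeSemiring.Binomial R.commutativeSemiring as Binomial

X : Poly
X = 0ℤ ∷ 1ℤ ∷ []

X*p≋0∷p : ∀ p → X *ᵖ p ≋ 0ℤ ∷ p
X*p≋0∷p p = mk≋ λ
  { zero    → 0∷-*ᵖ 1ᵖ p 0
  ; (suc i) → trans (0∷-*ᵖ 1ᵖ p (suc i)) (*ᵖ-identityˡ p i) }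

·ᵖ≋[]*ᵖ : ∀ c p → c ·ᵖ p ≋ [ c ] *ᵖ p
·ᵖ≋[]*ᵖ c p = mk≋ λ i → sym (trans (coeff-+ᵖ (c ·ᵖ p) [ 0ℤ ] i)
  (trans (cong (λ e → coeff (c ·ᵖ p) i + e) (coeff-[0] i)) (ℤ.+-identityʳ _)))
  where
  coeff-[0] : ∀ i → coeff [ 0ℤ ] i ≡ 0ℤ
  coeff-[0] zero    = refl
  coeff-[0] (suc i) = refl

coeff-[]*ᵖ : ∀ c p i → coeff ([ c ] *ᵖ p) i ≡ c * coeff p i
coeff-[]*ᵖ c p i = trans (sym (at (·ᵖ≋[]*ᵖ c p) i)) (coeff-·ᵖ c p i)

∷≋ : ∀ a p → a ∷ p ≋ [ a ] +ᵖ X *ᵖ p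
∷≋ a p = R.trans
  (mk≋ λ { zero → sym (ℤ.+-identityʳ a) ; (suc i) → refl })
  (R.+-congˡ {[ a ]} (R.sym (X*p≋0∷p p)))

[*]≋ : ∀ a b → [ a * b ] ≋ [ a ] *ᵖ [ b ]
[*]≋ a b = mk≋ λ { zero → sym (ℤ.+-identityʳ _) ; (suc i) → refl }

[0]≋[] : [ 0ℤ ] ≋ []
[0]≋[] = mk≋ λ { zero → refl ; (suc i) → refl }

-- Leading coefficients multiply, and ℤ has no zero divisors.
*ᵖ-zeroProduct : ∀ p q → p *ᵖ q ≋ [] → p ≋ [] ⊎ q ≋ []
*ᵖ-zeroProduct p q (mk≋ pq≈0) with degree p | degree q
... | inj₁ p≈0             | _                    = inj₁ (mk≋ p≈0)
... | inj₂ _               | inj₁ q≈0             = inj₂ (mk≋ q≈0)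
... | inj₂ (k , pk≢0 , vp) | inj₂ (d , qd≢0 , vq) =
  ⊥-elim ([ pk≢0 , qd≢0 ]′ (ℤ.i*j≡0⇒i≡0∨j≡0 (coeff p k)
    (trans (sym (coeff-*ᵖ-top p q k d vp vq)) (pq≈0 (k ℕ.+ d)))))

p-q≋0⇒p≋q : ∀ {p q} → p +ᵖ -ᵖ q ≋ [] → p ≋ q
p-q≋0⇒p≋q {p} {q} e = begin
  p               ≈⟨ split p q ⟩
  p +ᵖ -ᵖ q +ᵖ q  ≈⟨ R.+-congʳ e ⟩
  q               ∎
  where
  open ≋-Reasoning
  split : ∀ p q → p ≋ p +ᵖ -ᵖ q +ᵖ q
  split = solve-∀ polySolverRing

*ᵖ-cancelʳ : ∀ {r p q} → ¬ (r ≋ []) → p *ᵖ r ≋ q *ᵖ r → p ≋ q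
*ᵖ-cancelʳ {r} {p} {q} r≉0 e with *ᵖ-zeroProduct (p +ᵖ -ᵖ q) r (begin
    (p +ᵖ -ᵖ q) *ᵖ r         ≈⟨ expand p q r ⟩
    p *ᵖ r +ᵖ -ᵖ (q *ᵖ r)    ≈⟨ R.+-congʳ e ⟩
    q *ᵖ r +ᵖ -ᵖ (q *ᵖ r)    ≈⟨ R.-‿inverseʳ (q *ᵖ r) ⟩
    []                       ∎)
  where
  open ≋-Reasoning
  expand : ∀ p q r → (p +ᵖ -ᵖ q) *ᵖ r ≋ p *ᵖ r +ᵖ -ᵖ (q *ᵖ r)
  expand = solve-∀ polySolverRing
... | inj₁ z = p-q≋0⇒p≋q z
... | inj₂ z = ⊥-elim (r≉0 z)

-- Evaluation at 1, division by x - 1, and the polynomials x ^ n - 1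

ε : Poly → ℤ
ε p = eval p 1ℤ

ε-∷ : ∀ a p → ε (a ∷ p) ≡ a + ε p
ε-∷ a p = cong (λ e → a + e) (ℤ.*-identityˡ (ε p))

ε-+ : ∀ p q → ε (p +ᵖ q) ≡ ε p + ε q
ε-+ []      q       = sym (ℤ.+-identityˡ _)
ε-+ (a ∷ p) []      = sym (ℤ.+-identityʳ _)
ε-+ (a ∷ p) (b ∷ q) = begin
  a + b + 1ℤ * ε (p +ᵖ q)            ≡⟨ cong (λ e → a + b + 1ℤ * e) (ε-+ p q) ⟩
  a + b + 1ℤ * (ε p + ε q)           ≡⟨ shuffle a b (ε p) (ε q) ⟩
  a + 1ℤ * ε p + (b + 1ℤ * ε q)      ∎
  where
  open ≡-Reasoning
  shuffle : ∀ a b c d → a + b + 1ℤ * (c + d) ≡ a + 1ℤ * c + (b + 1ℤ * d)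
  shuffle = ℤSolver.solve-∀

ε-· : ∀ c p → ε (c ·ᵖ p) ≡ c * ε p
ε-· c []      = sym (ℤ.*-zeroʳ c)
ε-· c (a ∷ p) = begin
  c * a + 1ℤ * ε (c ·ᵖ p)  ≡⟨ cong (λ e → c * a + 1ℤ * e) (ε-· c p) ⟩
  c * a + 1ℤ * (c * ε p)   ≡⟨ factor c a (ε p) ⟩
  c * (a + 1ℤ * ε p)       ∎
  where
  open ≡-Reasoning
  factor : ∀ c a b → c * a + 1ℤ * (c * b) ≡ c * (a + 1ℤ * b)
  factor = ℤSolver.solve-∀

ε-* : ∀ p q → ε (p *ᵖ q) ≡ ε p * ε q
ε-* []      q = refl
ε-* (a ∷ p) q = begin
  ε (a ·ᵖ q +ᵖ (0ℤ ∷ p *ᵖ q))      ≡⟨ ε-+ (a ·ᵖ q) (0ℤ ∷ p *ᵖ q) ⟩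
  ε (a ·ᵖ q) + (0ℤ + 1ℤ * ε (p *ᵖ q))  ≡⟨ cong₂ (λ x y → x + (0ℤ + 1ℤ * y)) (ε-· a q) (ε-* p q) ⟩
  a * ε q + (0ℤ + 1ℤ * (ε p * ε q))      ≡⟨ factor a (ε p) (ε q) ⟩
  (a + 1ℤ * ε p) * ε q             ∎
  where
  open ≡-Reasoning
  factor : ∀ a p q → a * q + (0ℤ + 1ℤ * (p * q)) ≡ (a + 1ℤ * p) * q
  factor = ℤSolver.solve-∀

ε-zero : ∀ p → Zero p → ε p ≡ 0ℤ
ε-zero []      z = refl
ε-zero (a ∷ p) z = trans (ε-∷ a p) (cong₂ _+_ (z 0) (ε-zero p (z ∘ suc)))

ε-cong : ∀ {p q} → p ≋ q → ε p ≡ ε q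
ε-cong {[]}    {q}     (mk≋ e) = sym (ε-zero q (sym ∘ e))
ε-cong {a ∷ p} {[]}    (mk≋ e) = ε-zero (a ∷ p) e
ε-cong {a ∷ p} {b ∷ q} (mk≋ e) = cong₂ (λ x y → x + 1ℤ * y) (e 0) (ε-cong {p} {q} (mk≋ (e ∘ suc)))

ε-[] : ∀ a → ε [ a ] ≡ a
ε-[] a = ℤ.+-identityʳ a

ε-- : ∀ p → ε (-ᵖ p) ≡ - ε p
ε-- p = begin
  ε (-ᵖ p)                   ≡⟨ ℤ.+-identityʳ _ ⟨
  ε (-ᵖ p) + 0ℤ              ≡⟨ cong (λ e → ε (-ᵖ p) + e) (ℤ.+-inverseʳ (ε p)) ⟨
  ε (-ᵖ p) + (ε p + - ε p)   ≡⟨ ℤ.+-assoc (ε (-ᵖ p)) (ε p) (- ε p) ⟨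
  ε (-ᵖ p) + ε p + - ε p     ≡⟨ cong (_+ - ε p) (ε-+ (-ᵖ p) p) ⟨
  ε (-ᵖ p +ᵖ p) + - ε p      ≡⟨ cong (_+ - ε p) (ε-cong (R.-‿inverseˡ p)) ⟩
  0ℤ + - ε p                 ≡⟨ ℤ.+-identityˡ _ ⟩
  - ε p                      ∎
  where open ≡-Reasoning

ε-X^ : ∀ n → ε (X ^ᵖ n) ≡ 1ℤ
ε-X^ zero    = refl
ε-X^ (suc n) = trans (ε-* X (X ^ᵖ n)) (cong (1ℤ *_) (ε-X^ n))

X-1 : Poly
X-1 = X +ᵖ -ᵖ 1ᵖ

-- Synthetic division: from p = q (x - 1) + p(1) it follows that a + x p has quotient x q + p(1) and
-- remainder a + p(1).
divide-by-X-1 : ∀ p → ∃ λ q → p ≋ q *ᵖ X-1 +ᵖ [ ε p ]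
divide-by-X-1 []      = [] , R.sym [0]≋[]
divide-by-X-1 (a ∷ p) with divide-by-X-1 p
... | q , p≋ = X *ᵖ q +ᵖ [ ε p ] , (begin
  a ∷ p                                              ≈⟨ ∷≋ a p ⟩
  [ a ] +ᵖ X *ᵖ p                                    ≈⟨ R.+-congˡ {[ a ]} (R.*-congˡ {X} p≋) ⟩
  [ a ] +ᵖ X *ᵖ (q *ᵖ X-1 +ᵖ [ ε p ])                ≈⟨ regroup [ a ] X q [ ε p ] ⟩
  (X *ᵖ q +ᵖ [ ε p ]) *ᵖ X-1 +ᵖ ([ a ] +ᵖ [ ε p ])   ≡⟨ cong (λ e → (X *ᵖ q +ᵖ [ ε p ]) *ᵖ X-1 +ᵖ [ e ]) (sym (ε-∷ a p)) ⟩
  (X *ᵖ q +ᵖ [ ε p ]) *ᵖ X-1 +ᵖ [ ε (a ∷ p) ]        ∎)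
  where
  open ≋-Reasoning
  regroup : ∀ a x q e → a +ᵖ x *ᵖ (q *ᵖ (x +ᵖ -ᵖ 1ᵖ) +ᵖ e) ≋ (x *ᵖ q +ᵖ e) *ᵖ (x +ᵖ -ᵖ 1ᵖ) +ᵖ (a +ᵖ e)
  regroup = solve-∀ polySolverRing

ε≡0⇒X-1∣ : ∀ p → ε p ≡ 0ℤ → ∃ λ q → p ≋ q *ᵖ X-1
ε≡0⇒X-1∣ p ε≡0 with divide-by-X-1 p
... | q , p≋ = q , (begin
  p                       ≈⟨ p≋ ⟩
  q *ᵖ X-1 +ᵖ [ ε p ]     ≡⟨ cong (λ e → q *ᵖ X-1 +ᵖ [ e ]) ε≡0 ⟩
  q *ᵖ X-1 +ᵖ [ 0ℤ ]      ≈⟨ R.+-congˡ {q *ᵖ X-1} [0]≋[] ⟩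
  q *ᵖ X-1 +ᵖ []          ≈⟨ R.+-identityʳ _ ⟩
  q *ᵖ X-1                ∎)
  where open ≋-Reasoning

X^n-1 : ℕ → Poly
X^n-1 n = X ^ᵖ n +ᵖ -ᵖ 1ᵖ

X^≋monomial : ∀ n → X ^ᵖ n ≋ replicate n 0ℤ ++ [ 1ℤ ]
X^≋monomial zero    = R.refl
X^≋monomial (suc n) = R.trans (X*p≋0∷p (X ^ᵖ n))
  (mk≋ λ { zero → refl ; (suc i) → at (X^≋monomial n) i })

x^[]-1≋ : ∀ n → x^[ n ]-1 ≋ X^n-1 n
x^[]-1≋ n = R.trans (R.+-comm [ -1ℤ ] (replicate n 0ℤ ++ [ 1ℤ ])) (R.+-congʳ (R.sym (X^≋monomial n)))

coeff-X^-diag : ∀ n → coeff (X ^ᵖ n) n ≡ 1ℤ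
coeff-X^-diag n = trans (at (X^≋monomial n) n) (go n)
  where
  go : ∀ n → coeff (replicate n 0ℤ ++ [ 1ℤ ]) n ≡ 1ℤ
  go zero    = refl
  go (suc n) = go n

coeff-X^-off : ∀ n i → i ≢ n → coeff (X ^ᵖ n) i ≡ 0ℤ
coeff-X^-off n i i≢n = trans (at (X^≋monomial n) i) (go n i i≢n)
  where
  go : ∀ n i → i ≢ n → coeff (replicate n 0ℤ ++ [ 1ℤ ]) i ≡ 0ℤ
  go zero    zero    0≢0 = ⊥-elim (0≢0 refl)
  go zero    (suc i) _   = refl
  go (suc n) zero    _   = refl
  go (suc n) (suc i) i≢n = go n i (i≢n ∘ cong suc)

coeff-X^n-1-top : ∀ k → coeff (X^n-1 (suc k)) (suc k) ≡ 1ℤ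
coeff-X^n-1-top k = trans (coeff-+ᵖ (X ^ᵖ suc k) (-ᵖ 1ᵖ) (suc k))
  (trans (ℤ.+-identityʳ _) (coeff-X^-diag (suc k)))

X^n-1-vanishes : ∀ k → VanishesFrom (suc (suc k)) (X^n-1 (suc k))
X^n-1-vanishes k (suc i) k<i = trans (coeff-+ᵖ (X ^ᵖ suc k) (-ᵖ 1ᵖ) (suc i))
  (trans (ℤ.+-identityʳ _) (coeff-X^-off (suc k) (suc i) (≢-sym (ℕ.<⇒≢ k<i))))

X^n-1≢0 : ∀ n .{{_ : ℕ.NonZero n}} → ¬ (X^n-1 n ≋ [])
X^n-1≢0 (suc k) (mk≋ e) with () ← trans (sym (coeff-X^n-1-top k)) (e (suc k))

X-1≋X^1-1 : X-1 ≋ X^n-1 1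
X-1≋X^1-1 = R.+-congʳ { -ᵖ 1ᵖ} (R.sym (R.*-identityʳ X))

X-1≢0 : ¬ (X-1 ≋ [])
X-1≢0 e = X^n-1≢0 1 (R.trans (R.sym X-1≋X^1-1) e)

-- As x ^ n - 1 is monic, the leading coefficient of p reappears in the product, n places higher,
-- where the product is supposed to vanish.
X^n-1-multiple-small⇒0 : ∀ n .{{_ : ℕ.NonZero n}} p → VanishesFrom n (p *ᵖ X^n-1 n) → p ≋ []
X^n-1-multiple-small⇒0 (suc k) p v with degree p
... | inj₁ z               = mk≋ z
... | inj₂ (d , pd≢0 , vp) = ⊥-elim (pd≢0 (begin
  coeff p d                                 ≡⟨ ℤ.*-identityʳ _ ⟨
  coeff p d * 1ℤ                            ≡⟨ cong (coeff p d *_) (coeff-X^n-1-top k) ⟨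
  coeff p d * coeff (X^n-1 (suc k)) (suc k)   ≡⟨ coeff-*ᵖ-top p (X^n-1 (suc k)) d (suc k) vp (X^n-1-vanishes k) ⟨
  coeff (p *ᵖ X^n-1 (suc k)) (d ℕ.+ suc k)    ≡⟨ v (d ℕ.+ suc k) (ℕ.m≤n+m (suc k) d) ⟩
  0ℤ                                        ∎))
  where open ≡-Reasoning

-- 1 + y + ⋯ + y ^ (n - 1) in Horner form. The case y = x is N; the case y = x ^ (p ^ i), n = p is
-- the cyclotomic polynomial at p ^ (i + 1).
geometric : Poly → ℕ → Poly
geometric y zero    = []
geometric y (suc n) = 1ᵖ +ᵖ y *ᵖ geometric y n

geometric-* : ∀ y n → geometric y n *ᵖ (y +ᵖ -ᵖ 1ᵖ) ≋ y ^ᵖ n +ᵖ -ᵖ 1ᵖ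
geometric-* y zero    = mk≋ λ { zero → refl ; (suc i) → refl }
geometric-* y (suc n) = begin
  (1ᵖ +ᵖ y *ᵖ geometric y n) *ᵖ (y +ᵖ -ᵖ 1ᵖ)             ≈⟨ expand y (geometric y n) ⟩
  y +ᵖ -ᵖ 1ᵖ +ᵖ y *ᵖ (geometric y n *ᵖ (y +ᵖ -ᵖ 1ᵖ))     ≈⟨ R.+-congˡ {y +ᵖ -ᵖ 1ᵖ} (R.*-congˡ {y} (geometric-* y n)) ⟩
  y +ᵖ -ᵖ 1ᵖ +ᵖ y *ᵖ (y ^ᵖ n +ᵖ -ᵖ 1ᵖ)                   ≈⟨ collapse y (y ^ᵖ n) ⟩
  y *ᵖ y ^ᵖ n +ᵖ -ᵖ 1ᵖ                                   ∎
  where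
  open ≋-Reasoning
  expand : ∀ y g → (1ᵖ +ᵖ y *ᵖ g) *ᵖ (y +ᵖ -ᵖ 1ᵖ) ≋ y +ᵖ -ᵖ 1ᵖ +ᵖ y *ᵖ (g *ᵖ (y +ᵖ -ᵖ 1ᵖ))
  expand = solve-∀ polySolverRing
  collapse : ∀ y z → y +ᵖ -ᵖ 1ᵖ +ᵖ y *ᵖ (z +ᵖ -ᵖ 1ᵖ) ≋ y *ᵖ z +ᵖ -ᵖ 1ᵖ
  collapse = solve-∀ polySolverRing

ε-geometric : ∀ y n → ε y ≡ 1ℤ → ε (geometric y n) ≡ + n
ε-geometric y zero    _    = refl
ε-geometric y (suc n) εy≡1 = begin
  ε (1ᵖ +ᵖ y *ᵖ geometric y n)      ≡⟨ ε-+ 1ᵖ (y *ᵖ geometric y n) ⟩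
  1ℤ + ε (y *ᵖ geometric y n)       ≡⟨ cong (λ e → 1ℤ + e) (ε-* y (geometric y n)) ⟩
  1ℤ + ε y * ε (geometric y n)      ≡⟨ cong₂ (λ a b → 1ℤ + a * b) εy≡1 (ε-geometric y n εy≡1) ⟩
  1ℤ + 1ℤ * + n                     ≡⟨ cong (λ e → 1ℤ + e) (ℤ.*-identityˡ (+ n)) ⟩
  + suc n                           ∎
  where open ≡-Reasoning

-- Multitilings as congruences modulo x ^ P − 1

infix 4 _≋_⟨mod_⟩
record _≋_⟨mod_⟩ (p q m : Poly) : Set where
  constructor _,_
  field
    quotient : Poly
    equality : p ≋ q +ᵖ quotient *ᵖ m

mod-reflexive : ∀ {p q m} → p ≋ q → p ≋ q ⟨mod m ⟩
mod-reflexive {p} {q} {m} e = [] , R.trans e (R.sym (R.+-identityʳ q))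

mod-sym : ∀ {p q m} → p ≋ q ⟨mod m ⟩ → q ≋ p ⟨mod m ⟩
mod-sym {p} {q} {m} (k , e) = -ᵖ k , (begin
  q                                   ≈⟨ cancel q k m ⟩
  q +ᵖ k *ᵖ m +ᵖ (-ᵖ k) *ᵖ m          ≈⟨ R.+-congʳ e ⟨
  p +ᵖ (-ᵖ k) *ᵖ m                    ∎)
  where
  open ≋-Reasoning
  cancel : ∀ q k m → q ≋ q +ᵖ k *ᵖ m +ᵖ (-ᵖ k) *ᵖ m
  cancel = solve-∀ polySolverRing

mod-trans : ∀ {p q r m} → p ≋ q ⟨mod m ⟩ → q ≋ r ⟨mod m ⟩ → p ≋ r ⟨mod m ⟩
mod-trans {p} {q} {r} {m} (k , e) (l , f) = l +ᵖ k , (begin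
  p                        ≈⟨ e ⟩
  q +ᵖ k *ᵖ m              ≈⟨ R.+-congʳ f ⟩
  r +ᵖ l *ᵖ m +ᵖ k *ᵖ m    ≈⟨ factor r l k m ⟩
  r +ᵖ (l +ᵖ k) *ᵖ m       ∎)
  where
  open ≋-Reasoning
  factor : ∀ r l k m → r +ᵖ l *ᵖ m +ᵖ k *ᵖ m ≋ r +ᵖ (l +ᵖ k) *ᵖ m
  factor = solve-∀ polySolverRing

mod-+ˡ : ∀ r {p q m} → p ≋ q ⟨mod m ⟩ → r +ᵖ p ≋ r +ᵖ q ⟨mod m ⟩
mod-+ˡ r {p} {q} {m} (k , e) = k , R.trans (R.+-congˡ {r} e) (R.sym (R.+-assoc r q (k *ᵖ m)))

mod-*ˡ : ∀ r {p q m} → p ≋ q ⟨mod m ⟩ → r *ᵖ p ≋ r *ᵖ q ⟨mod m ⟩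
mod-*ˡ r {p} {q} {m} (k , e) = r *ᵖ k , R.trans (R.*-congˡ {r} e) (distribute r q k m)
  where
  distribute : ∀ r q k m → r *ᵖ (q +ᵖ k *ᵖ m) ≋ r *ᵖ q +ᵖ r *ᵖ k *ᵖ m
  distribute = solve-∀ polySolverRing

-- Normal forms modulo x ^ n - 1

coeff-applyUpTo-< : ∀ (w : ℕ → ℤ) n i → i ℕ.< n → coeff (applyUpTo w n) i ≡ w i
coeff-applyUpTo-< w (suc n) zero    _         = refl
coeff-applyUpTo-< w (suc n) (suc i) (s≤s i<n) = coeff-applyUpTo-< (w ∘ suc) n i i<n

applyUpTo-vanishes : ∀ (w : ℕ → ℤ) n → VanishesFrom n (applyUpTo w n)
applyUpTo-vanishes w zero    i       _         = refl
applyUpTo-vanishes w (suc n) (suc i) (s≤s n≤i) = applyUpTo-vanishes (w ∘ suc) n i n≤i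

applyUpTo-cong : ∀ (f g : ℕ → ℤ) n → (∀ i → i ℕ.< n → f i ≡ g i) → applyUpTo f n ≡ applyUpTo g n
applyUpTo-cong f g zero    e = refl
applyUpTo-cong f g (suc n) e =
  cong₂ _∷_ (e 0 (s≤s z≤n)) (applyUpTo-cong (f ∘ suc) (g ∘ suc) n λ i i<n → e (suc i) (s≤s i<n))

tabulate-toℕ : ∀ (f : ℕ → ℤ) n → tabulate {n = n} (f ∘ toℕ) ≡ applyUpTo f n
tabulate-toℕ f zero    = refl
tabulate-toℕ f (suc n) = cong (f 0 ∷_) (tabulate-toℕ (f ∘ suc) n)

applyUpTo-suc : ∀ w k → applyUpTo w (suc k) ≋ applyUpTo w k +ᵖ [ w k ] *ᵖ X ^ᵖ k
applyUpTo-suc w zero    = R.sym (R.*-identityʳ [ w 0 ])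
applyUpTo-suc w (suc k) = begin
  w 0 ∷ applyUpTo (w ∘ suc) (suc k)
    ≈⟨ ∷≋ (w 0) (applyUpTo (w ∘ suc) (suc k)) ⟩
  [ w 0 ] +ᵖ X *ᵖ applyUpTo (w ∘ suc) (suc k)
    ≈⟨ R.+-congˡ {[ w 0 ]} (R.*-congˡ {X} (applyUpTo-suc (w ∘ suc) k)) ⟩
  [ w 0 ] +ᵖ X *ᵖ (applyUpTo (w ∘ suc) k +ᵖ [ w (suc k) ] *ᵖ X ^ᵖ k)
    ≈⟨ regroup [ w 0 ] X (applyUpTo (w ∘ suc) k) [ w (suc k) ] (X ^ᵖ k) ⟩
  ([ w 0 ] +ᵖ X *ᵖ applyUpTo (w ∘ suc) k) +ᵖ [ w (suc k) ] *ᵖ (X *ᵖ X ^ᵖ k)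
    ≈⟨ R.+-congʳ (∷≋ (w 0) (applyUpTo (w ∘ suc) k)) ⟨
  (w 0 ∷ applyUpTo (w ∘ suc) k) +ᵖ [ w (suc k) ] *ᵖ (X *ᵖ X ^ᵖ k)
    ∎
  where
  open ≋-Reasoning
  regroup : ∀ a x t c y → a +ᵖ x *ᵖ (t +ᵖ c *ᵖ y) ≋ (a +ᵖ x *ᵖ t) +ᵖ c *ᵖ (x *ᵖ y)
  regroup = solve-∀ polySolverRing

applyUpTo-linear : ∀ a (w w′ : ℕ → ℤ) n →
  applyUpTo (λ i → w i * a + w′ i) n ≋ [ a ] *ᵖ applyUpTo w n +ᵖ applyUpTo w′ n
applyUpTo-linear a w w′ n = mk≋ λ i → trans (go w w′ n i) (sym (begin
  coeff ([ a ] *ᵖ applyUpTo w n +ᵖ applyUpTo w′ n) i              ≡⟨ coeff-+ᵖ ([ a ] *ᵖ applyUpTo w n) _ i ⟩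
  coeff ([ a ] *ᵖ applyUpTo w n) i + coeff (applyUpTo w′ n) i     ≡⟨ cong (_+ coeff (applyUpTo w′ n) i) (coeff-[]*ᵖ a (applyUpTo w n) i) ⟩
  a * coeff (applyUpTo w n) i + coeff (applyUpTo w′ n) i          ≡⟨ cong (_+ coeff (applyUpTo w′ n) i) (ℤ.*-comm a (coeff (applyUpTo w n) i)) ⟩
  coeff (applyUpTo w n) i * a + coeff (applyUpTo w′ n) i          ∎))
  where
  open ≡-Reasoning
  go : ∀ (w w′ : ℕ → ℤ) n i →
    coeff (applyUpTo (λ i → w i * a + w′ i) n) i ≡ coeff (applyUpTo w n) i * a + coeff (applyUpTo w′ n) i
  go w w′ zero    i       = refl
  go w w′ (suc n) zero    = refl
  go w w′ (suc n) (suc i) = go (w ∘ suc) (w′ ∘ suc) n i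

applyUpTo-const : ∀ m n → applyUpTo (const m) n ≋ [ m ] *ᵖ geometric X n
applyUpTo-const m zero    = R.sym (R.zeroʳ [ m ])
applyUpTo-const m (suc n) = begin
  m ∷ applyUpTo (const m) n                        ≈⟨ ∷≋ m _ ⟩
  [ m ] +ᵖ X *ᵖ applyUpTo (const m) n              ≈⟨ R.+-congˡ {[ m ]} (R.*-congˡ {X} (applyUpTo-const m n)) ⟩
  [ m ] +ᵖ X *ᵖ ([ m ] *ᵖ geometric X n)           ≈⟨ factor [ m ] X (geometric X n) ⟩
  [ m ] *ᵖ (1ᵖ +ᵖ X *ᵖ geometric X n)              ∎
  where
  open ≋-Reasoning
  factor : ∀ m x g → m +ᵖ x *ᵖ (m *ᵖ g) ≋ m *ᵖ (1ᵖ +ᵖ x *ᵖ g)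
  factor = solve-∀ polySolverRing

applyUpTo-0 : ∀ n → applyUpTo (const 0ℤ) n ≋ []
applyUpTo-0 n = R.trans (applyUpTo-const 0ℤ n) (R.*-congʳ {geometric X n} [0]≋[])

-- Both lists vanish from n on, hence so does the multiple of x ^ n - 1 by which they differ; such a
-- multiple is 0.
applyUpTo-injective-mod : ∀ n .{{_ : NonZero n}} (w w′ : ℕ → ℤ) →
  applyUpTo w n ≋ applyUpTo w′ n ⟨mod X^n-1 n ⟩ → ∀ i → i ℕ.< n → w i ≡ w′ i
applyUpTo-injective-mod n w w′ (k , e) i i<n = begin
  w i                                     ≡⟨ coeff-applyUpTo-< w n i i<n ⟨
  coeff W i                               ≡⟨ at e i ⟩
  coeff (W′ +ᵖ k *ᵖ X^n-1 n) i            ≡⟨ at (R.+-congˡ {W′} (R.*-congʳ {X^n-1 n} k≋0)) i ⟩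
  coeff (W′ +ᵖ []) i                      ≡⟨ at (R.+-identityʳ W′) i ⟩
  coeff W′ i                              ≡⟨ coeff-applyUpTo-< w′ n i i<n ⟩
  w′ i                                    ∎
  where
  open ≡-Reasoning
  W  = applyUpTo w n
  W′ = applyUpTo w′ n
  k≋0 : k ≋ []
  k≋0 = X^n-1-multiple-small⇒0 n k λ j n≤j → begin
    coeff (k *ᵖ X^n-1 n) j                      ≡⟨ ℤ.+-identityˡ _ ⟨
    0ℤ + coeff (k *ᵖ X^n-1 n) j                 ≡⟨ cong (_+ _) (applyUpTo-vanishes w′ n j n≤j) ⟨
    coeff W′ j + coeff (k *ᵖ X^n-1 n) j         ≡⟨ coeff-+ᵖ W′ (k *ᵖ X^n-1 n) j ⟨
    coeff (W′ +ᵖ k *ᵖ X^n-1 n) j                ≡⟨ at e j ⟨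
    coeff W j                                   ≡⟨ applyUpTo-vanishes w n j n≤j ⟩
    0ℤ                                          ∎

-- Multiplication by x pushes the top coefficient `w k` to degree n = k + 1, and modulo x ^ n - 1 it
-- wraps around to the constant term.
residue : ∀ n .{{_ : NonZero n}} p → ∃ λ (w : ℕ → ℤ) → p ≋ applyUpTo w n ⟨mod X^n-1 n ⟩
residue n       []      = const 0ℤ , mod-reflexive (R.sym (applyUpTo-0 n))
residue (suc k) (a ∷ p) with residue (suc k) p
... | w , (q , e) = w′ , (X *ᵖ q +ᵖ [ w k ] , (begin
  a ∷ p
    ≈⟨ ∷≋ a p ⟩
  [ a ] +ᵖ X *ᵖ p
    ≈⟨ R.+-congˡ {[ a ]} (R.*-congˡ {X} (R.trans e (R.+-congʳ (applyUpTo-suc w k)))) ⟩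
  [ a ] +ᵖ X *ᵖ (applyUpTo w k +ᵖ [ w k ] *ᵖ X ^ᵖ k +ᵖ q *ᵖ X^n-1 (suc k))
    ≈⟨ regroup [ a ] X (applyUpTo w k) [ w k ] (X ^ᵖ k) q ⟩
  [ a ] +ᵖ [ w k ] +ᵖ X *ᵖ applyUpTo w k +ᵖ (X *ᵖ q +ᵖ [ w k ]) *ᵖ X^n-1 (suc k)
    ≈⟨ R.+-congʳ (∷≋ (a + w k) (applyUpTo w k)) ⟨
  applyUpTo w′ (suc k) +ᵖ (X *ᵖ q +ᵖ [ w k ]) *ᵖ X^n-1 (suc k)
    ∎))
  where
  open ≋-Reasoning
  w′ : ℕ → ℤ
  w′ zero    = a + w k
  w′ (suc i) = w i
  regroup : ∀ a x t c y q →
    a +ᵖ x *ᵖ (t +ᵖ c *ᵖ y +ᵖ q *ᵖ (x *ᵖ y +ᵖ -ᵖ 1ᵖ)) ≋ a +ᵖ c +ᵖ x *ᵖ t +ᵖ (x *ᵖ q +ᵖ c) *ᵖ (x *ᵖ y +ᵖ -ᵖ 1ᵖ)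
  regroup = solve-∀ polySolverRing

-- Convolution on ℤ/nℤ as multiplication modulo x ^ n - 1

module Cyclic (k : ℕ) where

  n : ℕ
  n = suc k

  Periodic : (ℕ → ℤ) → Set
  Periodic w = ∀ i → w (n ℕ.+ i) ≡ w i

  -- On functions of period n, adding k = n − 1 to the argument shifts
  -- by −1, which is multiplication by x modulo x ^ n − 1.
  act : Poly → (ℕ → ℤ) → ℕ → ℤ
  act []      w i = 0ℤ
  act (a ∷ p) w i = w i * a + act p w (k ℕ.+ i)

  act-periodic : ∀ p {w} → Periodic w → Periodic (act p w)
  act-periodic []      per i = refl
  act-periodic (a ∷ p) {w} per i = cong₂ (λ x y → x * a + y) (per i)
    (trans (cong (act p w) (+-shuffle.x∙yz≈y∙xz k n i)) (act-periodic p per (k ℕ.+ i)))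
    where module +-shuffle = Algebra.Properties.CommutativeSemigroup ℕ.+-commutativeSemigroup

  X*applyUpTo : ∀ {w} → Periodic w → X *ᵖ applyUpTo w n ≋ applyUpTo (w ∘ (k ℕ.+_)) n ⟨mod X^n-1 n ⟩
  X*applyUpTo {w} per = [ w k ] , (begin
    X *ᵖ applyUpTo w n
      ≈⟨ R.*-congˡ {X} (applyUpTo-suc w k) ⟩
    X *ᵖ (applyUpTo w k +ᵖ [ w k ] *ᵖ X ^ᵖ k)
      ≈⟨ regroup X (applyUpTo w k) [ w k ] (X ^ᵖ k) ⟩
    [ w k ] +ᵖ X *ᵖ applyUpTo w k +ᵖ [ w k ] *ᵖ X^n-1 n
      ≈⟨ R.+-congʳ (∷≋ (w k) (applyUpTo w k)) ⟨
    (w k ∷ applyUpTo w k) +ᵖ [ w k ] *ᵖ X^n-1 n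
      -- After the shift, position 0 holds `w k`, and position i + 1 holds w (k + (i + 1)) = w (n +
      -- i), which is `w i` by periodicity.
      ≡⟨ cong (_+ᵖ [ w k ] *ᵖ X^n-1 n) (cong₂ _∷_ (cong w (sym (ℕ.+-identityʳ k)))
           (applyUpTo-cong _ _ k λ i _ → sym (trans (cong w (ℕ.+-suc k i)) (per i)))) ⟩
    applyUpTo (w ∘ (k ℕ.+_)) n +ᵖ [ w k ] *ᵖ X^n-1 n
      ∎)
    where
    open ≋-Reasoning
    regroup : ∀ x t c y → x *ᵖ (t +ᵖ c *ᵖ y) ≋ c +ᵖ x *ᵖ t +ᵖ c *ᵖ (x *ᵖ y +ᵖ -ᵖ 1ᵖ)
    regroup = solve-∀ polySolverRing

  act-applyUpTo : ∀ p {w} → Periodic w → p *ᵖ applyUpTo w n ≋ applyUpTo (act p w) n ⟨mod X^n-1 n ⟩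
  act-applyUpTo [] per = mod-reflexive (R.sym (applyUpTo-0 n))
  act-applyUpTo (a ∷ p) {w} per =
    mod-trans (mod-reflexive expand)
    (mod-trans (mod-+ˡ ([ a ] *ᵖ W) (mod-trans (mod-*ˡ X (act-applyUpTo p per)) (X*applyUpTo (act-periodic p per))))
    (mod-reflexive (R.sym (applyUpTo-linear a w (act p w ∘ (k ℕ.+_)) n))))
    where
    W = applyUpTo w n
    distribute : ∀ a x p w → (a +ᵖ x *ᵖ p) *ᵖ w ≋ a *ᵖ w +ᵖ x *ᵖ (p *ᵖ w)
    distribute = solve-∀ polySolverRing
    expand : (a ∷ p) *ᵖ W ≋ [ a ] *ᵖ W +ᵖ X *ᵖ (p *ᵖ W)
    expand = R.trans (R.*-congʳ (∷≋ a p)) (distribute [ a ] X p W)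

  act-tabulate : ∀ {l} (v : Fin l → ℤ) w i →
    act (tabulate v) w i ≡ sum (λ h → w (toℕ h ℕ.* k ℕ.+ i) * v h)
  act-tabulate {zero}  v w i = refl
  act-tabulate {suc l} v w i = cong (λ s → w i * v fzero + s) (trans (act-tabulate (v ∘ fsuc) w (k ℕ.+ i))
    (sum-cong-≗ λ h → cong (λ j → w j * v (fsuc h)) (shuffle (toℕ h ℕ.* k) k i)))
    where
    shuffle : ∀ a b c → a ℕ.+ (b ℕ.+ c) ≡ b ℕ.+ a ℕ.+ c
    shuffle = ℕSolver.solve-∀

  module _ (u : Fin n → ℤ) where

    periodic : ℕ → ℤ
    periodic i = u (i mod n)

    mod-cong : ∀ i j → i % n ≡ j % n → periodic i ≡ periodic j
    mod-cong i j e = cong u (Fin.fromℕ<-cong _ _ e (m%n<n i n) (m%n<n j n))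

    periodic-Periodic : Periodic periodic
    periodic-Periodic i = mod-cong (n ℕ.+ i) i (trans (cong (_% n) (ℕ.+-comm n i)) ([m+n]%n≡m%n i n))

    periodic-toℕ : ∀ i → periodic (toℕ i) ≡ u i
    periodic-toℕ i = cong u (Fin.toℕ-injective (trans (Fin.toℕ-fromℕ< (m%n<n (toℕ i) n)) (m<n⇒m%n≡m (Fin.toℕ<n i))))

    Q≋applyUpTo : Q u ≋ applyUpTo periodic n
    Q≋applyUpTo = R.reflexive (trans (tabulate-cong (sym ∘ periodic-toℕ)) (tabulate-toℕ periodic n))

    -- Since k ≡ -1 modulo n, h k + g represents g - h without a subtraction in ℕ. Adding h n to the
    -- other side makes up for the truncated n ∸ h.
    ⊖-shift : ∀ g h → u (g ⊖ h) ≡ periodic (toℕ h ℕ.* k ℕ.+ toℕ g)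
    ⊖-shift g h = mod-cong (toℕ g ℕ.+ (n ℕ.∸ toℕ h)) (toℕ h ℕ.* k ℕ.+ toℕ g) (begin
      (toℕ g ℕ.+ (n ℕ.∸ toℕ h)) % n
        ≡⟨ [m+kn]%n≡m%n (toℕ g ℕ.+ (n ℕ.∸ toℕ h)) (toℕ h) n ⟨
      (toℕ g ℕ.+ (n ℕ.∸ toℕ h) ℕ.+ toℕ h ℕ.* n) % n
        ≡⟨ cong (_% n) (shuffle (toℕ g) (n ℕ.∸ toℕ h) (toℕ h) k) ⟩
      (toℕ h ℕ.* k ℕ.+ toℕ g ℕ.+ (n ℕ.∸ toℕ h ℕ.+ toℕ h)) % n
        ≡⟨ cong (λ l → (toℕ h ℕ.* k ℕ.+ toℕ g ℕ.+ l) % n) (ℕ.m∸n+n≡m (ℕ.<⇒≤ (Fin.toℕ<n h))) ⟩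
      (toℕ h ℕ.* k ℕ.+ toℕ g ℕ.+ n) % n
        ≡⟨ [m+n]%n≡m%n (toℕ h ℕ.* k ℕ.+ toℕ g) n ⟩
      (toℕ h ℕ.* k ℕ.+ toℕ g) % n
        ∎)
      where
      open ≡-Reasoning
      shuffle : ∀ g d h k → g ℕ.+ d ℕ.+ h ℕ.* (1 ℕ.+ k) ≡ h ℕ.* k ℕ.+ g ℕ.+ (d ℕ.+ h)
      shuffle = ℕSolver.solve-∀

    sum-⊖ : ∀ (v : Fin n → ℤ) g → sum (λ h → u (g ⊖ h) * v h) ≡ act (Q v) periodic (toℕ g)
    sum-⊖ v g = trans (sum-cong-≗ λ h → cong (_* v h) (⊖-shift g h)) (sym (act-tabulate v periodic (toℕ g)))

    Q*Q : ∀ (v : Fin n → ℤ) → Q v *ᵖ Q u ≋ applyUpTo (act (Q v) periodic) n ⟨mod X^n-1 n ⟩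
    Q*Q v = mod-trans (mod-reflexive (R.*-congˡ {Q v} Q≋applyUpTo)) (act-applyUpTo (Q v) periodic-Periodic)

    multitiling⇒mod : ∀ {m} {v : Fin n → ℤ} → IsMultitiling u m v → Q v *ᵖ Q u ≋ [ m ] *ᵖ geometric X n ⟨mod X^n-1 n ⟩
    multitiling⇒mod {m} {v} tiles = mod-trans (Q*Q v) (mod-reflexive (R.trans
      (R.reflexive (applyUpTo-cong _ (const m) n λ i i<n →
        trans (cong (act (Q v) periodic) (sym (Fin.toℕ-fromℕ< i<n)))
          (trans (sym (sum-⊖ v (fromℕ< i<n))) (tiles (fromℕ< i<n)))))
      (applyUpTo-const m n)))

    mod⇒multitiling : ∀ {m} {v : Fin n → ℤ} → Q v *ᵖ Q u ≋ [ m ] *ᵖ geometric X n ⟨mod X^n-1 n ⟩ → IsMultitiling u m v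
    mod⇒multitiling {m} {v} e g = trans (sum-⊖ v g) (applyUpTo-injective-mod n (act (Q v) periodic) (const m)
      (mod-trans (mod-sym (Q*Q v)) (mod-trans e (mod-reflexive (R.sym (applyUpTo-const m n)))))
      (toℕ g) (Fin.toℕ<n g))

-- Primality in ℤ[x]

prime>1 : ∀ {p} → Prime p → 1 ℕ.< p
prime>1 {p} pr = ℕ.nonTrivial⇒n>1 p {{prime⇒nonTrivial pr}}

prime∤! : ∀ {p} → Prime p → ∀ {k} → k ℕ.< p → p ∤ k !
prime∤! {p} pr {zero}  _   p∣1 = ¬prime[1] (subst Prime (∣1⇒≡1 p∣1) pr)
prime∤! {p} pr {suc k} k<p p∣  with euclidsLemma (suc k) (k !) pr p∣
... | inj₁ p∣k = ℕ.<⇒≱ k<p (∣⇒≤ p∣k)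
... | inj₂ p∣! = prime∤! pr (ℕ.<-trans (ℕ.n<1+n k) k<p) p∣!

-- p divides p! = C(p, k) k! (p - k)!, but neither of the two factorials.
prime∣C : ∀ {p k} → Prime p → 0 ℕ.< k → k ℕ.< p → p ℕ∣.∣ p C k
prime∣C {p} {suc k} pr _ k<p with
  euclidsLemma (p C suc k) (suc k ! ℕ.* (p ∸ suc k) !) pr (subst (p ℕ∣.∣_) (sym C*) (p∣p! p (prime⇒nonZero pr)))
  where
  p∣p! : ∀ p → NonZero p → p ℕ∣.∣ p !
  p∣p! (suc p) _ = m∣m*n (p !)
  C* : (p C suc k) ℕ.* (suc k ! ℕ.* (p ∸ suc k) !) ≡ p !
  C* = trans (cong (ℕ._* (suc k ! ℕ.* (p ∸ suc k) !)) (nCk≡n!/k![n-k]! (ℕ.<⇒≤ k<p)))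
         (m/n*n≡m {{ℕ._!*_!≢0 (suc k) (p ∸ suc k)}} (k![n∸k]!∣n! (ℕ.<⇒≤ k<p)))
... | inj₁ p∣C = p∣C
... | inj₂ p∣k!* with euclidsLemma (suc k !) ((p ∸ suc k) !) pr p∣k!*
...   | inj₁ p∣k! = ⊥-elim (prime∤! pr k<p p∣k!)
...   | inj₂ p∣!  = ⊥-elim (prime∤! pr (ℕ.∸-monoʳ-< {p} {suc k} {0} (s≤s z≤n) (ℕ.<⇒≤ k<p)) p∣!)

×ᵖ≋[]*ᵖ : ∀ n q → n ×ᵖ q ≋ [ + n ] *ᵖ q
×ᵖ≋[]*ᵖ zero    q = R.sym (R.*-congʳ {q} [0]≋[])
×ᵖ≋[]*ᵖ (suc n) q = begin
  q +ᵖ n ×ᵖ q              ≈⟨ R.+-congˡ {q} (×ᵖ≋[]*ᵖ n q) ⟩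
  q +ᵖ [ + n ] *ᵖ q        ≈⟨ factor q [ + n ] ⟩
  (1ᵖ +ᵖ [ + n ]) *ᵖ q     ∎
  where
  open ≋-Reasoning
  factor : ∀ q c → q +ᵖ c *ᵖ q ≋ (1ᵖ +ᵖ c) *ᵖ q
  factor = solve-∀ polySolverRing

-- All binomial coefficients except the two outer ones are multiples of p, so the first and the last
-- term of the binomial sum are split off.
freshman : ∀ {p} → Prime p → ∀ x y → ∃ λ z → (x +ᵖ y) ^ᵖ p ≋ x ^ᵖ p +ᵖ y ^ᵖ p +ᵖ [ + p ] *ᵖ z
freshman {suc n} pr x y = sumᵖ (proj₁ ∘ middle) , (begin
  (x +ᵖ y) ^ᵖ p
    ≈⟨ Binomial.theorem p x y ⟩
  t fzero +ᵖ sumᵖ (t ∘ fsuc)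
    ≈⟨ R.+-cong t-first (R.trans (sum-init-last (t ∘ fsuc)) (R.+-cong t-middle t-last)) ⟩
  y ^ᵖ p +ᵖ ([ + p ] *ᵖ sumᵖ (proj₁ ∘ middle) +ᵖ x ^ᵖ p)
    ≈⟨ regroup (x ^ᵖ p) (y ^ᵖ p) _ ⟩
  x ^ᵖ p +ᵖ y ^ᵖ p +ᵖ [ + p ] *ᵖ sumᵖ (proj₁ ∘ middle)
    ∎)
  where
  open ≋-Reasoning
  p = suc n
  t = Binomial.binomialTerm x y p
  regroup : ∀ a b c → b +ᵖ (c +ᵖ a) ≋ a +ᵖ b +ᵖ c
  regroup = solve-∀ polySolverRing
  t-first : t fzero ≋ y ^ᵖ p
  t-first = R.trans (R.+-identityʳ (1ᵖ *ᵖ y ^ᵖ p)) (R.*-identityˡ (y ^ᵖ p))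
  middle : ∀ (i : Fin n) → ∃ λ z → t (fsuc (inject₁ i)) ≋ [ + p ] *ᵖ z
  middle i with prime∣C {p} {suc (toℕ (inject₁ i))} pr (s≤s z≤n)
                (s≤s (subst (ℕ._< n) (sym (Fin.toℕ-inject₁ i)) (Fin.toℕ<n i)))
  ... | divides q C≡q*p = [ + q ] *ᵖ b , (begin
    t (fsuc (inject₁ i))                   ≈⟨ ×ᵖ≋[]*ᵖ (p C suc (toℕ (inject₁ i))) b ⟩
    [ + (p C suc (toℕ (inject₁ i))) ] *ᵖ b ≡⟨ cong (λ c → [ c ] *ᵖ b) (trans (cong +_ C≡q*p) (ℤ.pos-* q p)) ⟩
    [ + q * + p ] *ᵖ b                     ≈⟨ R.*-congʳ {b} ([*]≋ (+ q) (+ p)) ⟩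
    [ + q ] *ᵖ [ + p ] *ᵖ b                ≈⟨ rearrange [ + q ] [ + p ] b ⟩
    [ + p ] *ᵖ ([ + q ] *ᵖ b)              ∎)
    where
    b = Binomial.binomial x y p (fsuc (inject₁ i))
    rearrange : ∀ q p b → q *ᵖ p *ᵖ b ≋ p *ᵖ (q *ᵖ b)
    rearrange = solve-∀ polySolverRing
  t-middle : sumᵖ (λ i → t (fsuc (inject₁ i))) ≋ [ + p ] *ᵖ sumᵖ (proj₁ ∘ middle)
  t-middle = R.trans (sumᵖ-cong (proj₂ ∘ middle)) (R.sym (*ᵖ-distribˡ-sum [ + p ] (proj₁ ∘ middle)))
  t-last : t (fsuc (fromℕ n)) ≋ x ^ᵖ p
  t-last = begin
    (p C suc (toℕ (fromℕ n))) ×ᵖ (x ^ᵖ suc (toℕ (fromℕ n)) *ᵖ y ^ᵖ (n ∸ toℕ (fromℕ n)))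
      ≡⟨ cong (λ k → (p C suc k) ×ᵖ (x ^ᵖ suc k *ᵖ y ^ᵖ (n ∸ k))) (Fin.toℕ-fromℕ n) ⟩
    (p C p) ×ᵖ (x ^ᵖ p *ᵖ y ^ᵖ (n ∸ n))
      ≡⟨ cong₂ (λ c k → c ×ᵖ (x ^ᵖ p *ᵖ y ^ᵖ k)) (nCn≡1 p) (ℕ.n∸n≡0 n) ⟩
    x ^ᵖ p *ᵖ 1ᵖ +ᵖ []
      ≈⟨ R.trans (R.+-identityʳ (x ^ᵖ p *ᵖ 1ᵖ)) (R.*-identityʳ (x ^ᵖ p)) ⟩
    x ^ᵖ p
      ∎

freshman-multiple : ∀ {p} → Prime p → ∀ y z → ∃ λ t → (y +ᵖ [ + p ] *ᵖ z) ^ᵖ p ≋ y ^ᵖ p +ᵖ [ + p ] *ᵖ t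
freshman-multiple {suc n} pr y z = let a , e = freshman pr y (c *ᵖ z) in
  z *ᵖ (c *ᵖ z) ^ᵖ n +ᵖ a , R.trans e (factor (y ^ᵖ suc n) c z ((c *ᵖ z) ^ᵖ n) a)
  where
  c = [ + suc n ]
  factor : ∀ t c z w a → t +ᵖ c *ᵖ z *ᵖ w +ᵖ c *ᵖ a ≋ t +ᵖ c *ᵖ (z *ᵖ w +ᵖ a)
  factor = solve-∀ polySolverRing

-- Expanding y = (y - 1) + 1 instead of y + (-1) avoids the sign (-1) ^ p and with it a special case
-- p = 2.
freshman-1 : ∀ {p} → Prime p → ∀ y → ∃ λ t → (y +ᵖ -ᵖ 1ᵖ) ^ᵖ p ≋ y ^ᵖ p +ᵖ -ᵖ 1ᵖ +ᵖ [ + p ] *ᵖ t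
freshman-1 {p} pr y = let b , e = freshman pr (y +ᵖ -ᵖ 1ᵖ) 1ᵖ in -ᵖ b , (begin
  (y +ᵖ -ᵖ 1ᵖ) ^ᵖ p
    ≈⟨ isolate ((y +ᵖ -ᵖ 1ᵖ) ^ᵖ p) [ + p ] b ⟩
  (y +ᵖ -ᵖ 1ᵖ) ^ᵖ p +ᵖ 1ᵖ +ᵖ [ + p ] *ᵖ b +ᵖ -ᵖ 1ᵖ +ᵖ [ + p ] *ᵖ -ᵖ b
    ≈⟨ R.+-congʳ {[ + p ] *ᵖ -ᵖ b} (R.+-congʳ { -ᵖ 1ᵖ} (R.+-congʳ {[ + p ] *ᵖ b} (R.+-congˡ {(y +ᵖ -ᵖ 1ᵖ) ^ᵖ p} (1^ p)))) ⟨
  (y +ᵖ -ᵖ 1ᵖ) ^ᵖ p +ᵖ 1ᵖ ^ᵖ p +ᵖ [ + p ] *ᵖ b +ᵖ -ᵖ 1ᵖ +ᵖ [ + p ] *ᵖ -ᵖ b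
    ≈⟨ R.+-congʳ {[ + p ] *ᵖ -ᵖ b} (R.+-congʳ { -ᵖ 1ᵖ} (R.trans (R.sym e) (^ᵖ-congˡ p (restore y)))) ⟩
  y ^ᵖ p +ᵖ -ᵖ 1ᵖ +ᵖ [ + p ] *ᵖ -ᵖ b
    ∎)
  where
  open ≋-Reasoning
  isolate : ∀ t c b → t ≋ t +ᵖ 1ᵖ +ᵖ c *ᵖ b +ᵖ -ᵖ 1ᵖ +ᵖ c *ᵖ -ᵖ b
  isolate = solve-∀ polySolverRing
  restore : ∀ y → y +ᵖ -ᵖ 1ᵖ +ᵖ 1ᵖ ≋ y
  restore = solve-∀ polySolverRing
  1^ : ∀ k → 1ᵖ ^ᵖ k ≋ 1ᵖ
  1^ zero    = R.refl
  1^ (suc k) = R.trans (R.*-identityˡ (1ᵖ ^ᵖ k)) (1^ k)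

-- For y = x and p ^ j = n this says that (x - 1) ^ n is a multiple of p modulo x ^ n - 1, and so
-- modulo each divisor of x ^ n - 1.
frobenius : ∀ {p} → Prime p → ∀ y j →
  ∃ λ z → (y +ᵖ -ᵖ 1ᵖ) ^ᵖ (p ^ j) ≋ y ^ᵖ (p ^ j) +ᵖ -ᵖ 1ᵖ +ᵖ [ + p ] *ᵖ z
frobenius {p} pr y zero = [] , base y [ + p ]
  where
  base : ∀ y c → (y +ᵖ -ᵖ 1ᵖ) *ᵖ 1ᵖ ≋ y *ᵖ 1ᵖ +ᵖ -ᵖ 1ᵖ +ᵖ c *ᵖ []
  base = solve-∀ polySolverRing
frobenius {p} pr y (suc j) =
  let z , e = frobenius pr y j
      a , f = freshman-multiple pr (y ^ᵖ (p ^ j) +ᵖ -ᵖ 1ᵖ) z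
      b , g = freshman-1 pr (y ^ᵖ (p ^ j))
  in b +ᵖ a , (begin
  (y +ᵖ -ᵖ 1ᵖ) ^ᵖ (p ℕ.* p ^ j)
    ≈⟨ ^-swap (y +ᵖ -ᵖ 1ᵖ) ⟩
  ((y +ᵖ -ᵖ 1ᵖ) ^ᵖ (p ^ j)) ^ᵖ p
    ≈⟨ R.trans (^ᵖ-congˡ p e) f ⟩
  (y ^ᵖ (p ^ j) +ᵖ -ᵖ 1ᵖ) ^ᵖ p +ᵖ [ + p ] *ᵖ a
    ≈⟨ R.+-congʳ {[ + p ] *ᵖ a} g ⟩
  (y ^ᵖ (p ^ j)) ^ᵖ p +ᵖ -ᵖ 1ᵖ +ᵖ [ + p ] *ᵖ b +ᵖ [ + p ] *ᵖ a
    ≈⟨ factor ((y ^ᵖ (p ^ j)) ^ᵖ p +ᵖ -ᵖ 1ᵖ) [ + p ] b a ⟩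
  (y ^ᵖ (p ^ j)) ^ᵖ p +ᵖ -ᵖ 1ᵖ +ᵖ [ + p ] *ᵖ (b +ᵖ a)
    ≈⟨ R.+-congʳ {[ + p ] *ᵖ (b +ᵖ a)} (R.+-congʳ { -ᵖ 1ᵖ} (^-swap y)) ⟨
  y ^ᵖ (p ℕ.* p ^ j) +ᵖ -ᵖ 1ᵖ +ᵖ [ + p ] *ᵖ (b +ᵖ a)
    ∎)
  where
  open ≋-Reasoning
  ^-swap : ∀ y → y ^ᵖ (p ℕ.* p ^ j) ≋ (y ^ᵖ (p ^ j)) ^ᵖ p
  ^-swap y = R.trans (R.reflexive (cong (y ^ᵖ_) (ℕ.*-comm p (p ^ j)))) (R.sym (^ᵖ-assocʳ y (p ^ j) p))
  factor : ∀ t c b a → t +ᵖ c *ᵖ b +ᵖ c *ᵖ a ≋ t +ᵖ c *ᵖ (b +ᵖ a)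
  factor = solve-∀ polySolverRing

infix 4 _∣ₚ_
-- `_∣ᵖ_` restated with the record `_≋_`, so that the polynomials can be inferred and ring reasoning
-- applies.
_∣ₚ_ : Poly → Poly → Set
p ∣ₚ q = ∃ λ r → r *ᵖ p ≋ q

sumAbs : (ℕ → ℤ) → ℕ → ℕ
sumAbs w zero    = 0
sumAbs w (suc n) = ∣ w 0 ∣ ℕ.+ sumAbs (w ∘ suc) n

∣∣≤sumAbs : ∀ w n i → i ℕ.< n → ∣ w i ∣ ℕ.≤ sumAbs w n
∣∣≤sumAbs w (suc n) zero    _         = ℕ.m≤m+n ∣ w 0 ∣ _
∣∣≤sumAbs w (suc n) (suc i) (s≤s i<n) =
  ℕ.≤-trans (∣∣≤sumAbs (w ∘ suc) n i i<n) (ℕ.m≤n+m _ ∣ w 0 ∣)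

∣∧small⇒0 : ∀ n i j → ∣ i ∣ ℕ.< n → i ≡ j * + n → i ≡ 0ℤ
∣∧small⇒0 n i j i<n i≡jn with ∣ i ∣ in eq
... | zero  = ℤ.∣i∣≡0⇒i≡0 eq
... | suc k = ⊥-elim (ℕ.<⇒≱ i<n (ℕ∣.∣⇒≤ (subst (n ℕ∣.∣_) eq
  (ℕ∣.divides ∣ j ∣ (trans (cong ∣_∣ i≡jn) (ℤ.abs-* j (+ n)))))))

[+]^ : ∀ p n → [ + p ] ^ᵖ n ≋ [ + (p ^ n) ]
[+]^ p zero    = R.refl
[+]^ p (suc n) = begin
  [ + p ] *ᵖ [ + p ] ^ᵖ n    ≈⟨ R.*-congˡ {[ + p ]} ([+]^ p n) ⟩
  [ + p ] *ᵖ [ + (p ^ n) ]   ≈⟨ [*]≋ (+ p) (+ (p ^ n)) ⟨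
  [ + p * + (p ^ n) ]        ≡⟨ cong [_] (ℤ.pos-* p (p ^ n)) ⟨
  [ + (p ^ suc n) ]          ∎
  where open ≋-Reasoning

euclidsLemmaℤ : ∀ {p} → Prime p → ∀ i j → + p ℤ∣.∣ i * j → + p ℤ∣.∣ i ⊎ + p ℤ∣.∣ j
euclidsLemmaℤ {p} pr i j p∣ij =
  Sum.map ℤ∣.∣ᵤ⇒∣ ℤ∣.∣ᵤ⇒∣ (euclidsLemma ∣ i ∣ ∣ j ∣ pr (subst (p ℕ∣.∣_) (ℤ.abs-* i j) (ℤ∣.∣⇒∣ᵤ p∣ij)))

-- In ℤ[x]/Φ the element x − 1 divides p = Φ(1), and p divides a power of
-- x − 1.  If Φ ∣ f g, then p divides f(1) g(1), so that a factor x − 1 can be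
-- split off from f or from g modulo Φ.  After many such steps one of them is
-- modulo Φ divisible by a power of p exceeding all coefficients of its
-- remainder, which is therefore zero.
module Primality
  {p} (pr : Prime p) (Φ B A : Poly) (n d : ℕ) .{{_ : NonZero n}}
  (ε-Φ : ε Φ ≡ + p)
  (B*Φ : B *ᵖ Φ ≋ X^n-1 n)
  (X-1^d : X-1 ^ᵖ d ≋ [ + p ] *ᵖ A +ᵖ B *ᵖ Φ)
  where

  instance
    p≢0 : NonZero p
    p≢0 = prime⇒nonZero pr

  B≢0 : ¬ (B ≋ [])
  B≢0 B≋0 = X^n-1≢0 n (R.trans (R.sym B*Φ) (R.*-congʳ {Φ} B≋0))

  SplitOff : Poly → Poly → Set
  SplitOff f g = ∃₂ λ f′ c → (f ≋ f′ *ᵖ X-1 +ᵖ c *ᵖ Φ) × Φ ∣ₚ f′ *ᵖ g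

  -- With f(1) = c p the polynomial f - c Φ vanishes at 1, which gives f′. Then f′ g (x - 1) = s Φ
  -- for some s, and evaluating at 1 gives s(1) p = 0; hence s is a multiple of x - 1 as well, and x
  -- - 1 cancels.
  splitOff : ∀ f g → + p ℤ∣.∣ ε f → Φ ∣ₚ f *ᵖ g → SplitOff f g
  splitOff f g (ℤ∣.divides c εf≡cp) (r , rΦ≋fg) =
    f′ , [ c ] , R.trans (restore f ([ c ] *ᵖ Φ)) (R.+-congʳ {[ c ] *ᵖ Φ} f-cΦ≋) , s′ ,
    *ᵖ-cancelʳ X-1≢0 (R.trans (swap s′ Φ X-1) (R.trans (R.*-congʳ {Φ} (R.sym s≋)) sΦ))
    where
    swap : ∀ a b c → a *ᵖ b *ᵖ c ≋ a *ᵖ c *ᵖ b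
    swap = solve-∀ polySolverRing
    restore : ∀ f c → f ≋ f +ᵖ -ᵖ c +ᵖ c
    restore = solve-∀ polySolverRing
    ε[f-cΦ]≡0 : ε (f +ᵖ -ᵖ ([ c ] *ᵖ Φ)) ≡ 0ℤ
    ε[f-cΦ]≡0 = begin
      ε (f +ᵖ -ᵖ ([ c ] *ᵖ Φ))        ≡⟨ ε-+ f (-ᵖ ([ c ] *ᵖ Φ)) ⟩
      ε f + ε (-ᵖ ([ c ] *ᵖ Φ))       ≡⟨ cong₂ _+_ εf≡cp (trans (ε-- ([ c ] *ᵖ Φ)) (cong -_ (ε-* [ c ] Φ))) ⟩
      c * + p + - (ε [ c ] * ε Φ)     ≡⟨ cong₂ (λ a b → c * + p + - (a * b)) (ε-[] c) ε-Φ ⟩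
      c * + p + - (c * + p)           ≡⟨ ℤ.+-inverseʳ (c * + p) ⟩
      0ℤ                              ∎
      where open ≡-Reasoning
    f′    = proj₁ (ε≡0⇒X-1∣ (f +ᵖ -ᵖ ([ c ] *ᵖ Φ)) ε[f-cΦ]≡0)
    f-cΦ≋ = proj₂ (ε≡0⇒X-1∣ (f +ᵖ -ᵖ ([ c ] *ᵖ Φ)) ε[f-cΦ]≡0)
    s     = r +ᵖ -ᵖ ([ c ] *ᵖ g)
    sΦ : s *ᵖ Φ ≋ f′ *ᵖ g *ᵖ X-1
    sΦ = begin
      s *ᵖ Φ                              ≈⟨ expand r [ c ] g Φ ⟩
      r *ᵖ Φ +ᵖ -ᵖ ([ c ] *ᵖ Φ *ᵖ g)      ≈⟨ R.+-congʳ { -ᵖ ([ c ] *ᵖ Φ *ᵖ g)} rΦ≋fg ⟩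
      f *ᵖ g +ᵖ -ᵖ ([ c ] *ᵖ Φ *ᵖ g)      ≈⟨ factor f [ c ] g Φ ⟩
      (f +ᵖ -ᵖ ([ c ] *ᵖ Φ)) *ᵖ g         ≈⟨ R.*-congʳ {g} f-cΦ≋ ⟩
      f′ *ᵖ X-1 *ᵖ g                      ≈⟨ swap f′ X-1 g ⟩
      f′ *ᵖ g *ᵖ X-1                      ∎
      where
      open ≋-Reasoning
      expand : ∀ r c g Φ → (r +ᵖ -ᵖ (c *ᵖ g)) *ᵖ Φ ≋ r *ᵖ Φ +ᵖ -ᵖ (c *ᵖ Φ *ᵖ g)
      expand = solve-∀ polySolverRing
      factor : ∀ f c g Φ → f *ᵖ g +ᵖ -ᵖ (c *ᵖ Φ *ᵖ g) ≋ (f +ᵖ -ᵖ (c *ᵖ Φ)) *ᵖ g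
      factor = solve-∀ polySolverRing
    εs≡0 : ε s ≡ 0ℤ
    εs≡0 = ℤ.*-cancelʳ-≡ (ε s) 0ℤ (+ p) (begin
      ε s * + p                  ≡⟨ cong (ε s *_) ε-Φ ⟨
      ε s * ε Φ                  ≡⟨ ε-* s Φ ⟨
      ε (s *ᵖ Φ)                 ≡⟨ ε-cong sΦ ⟩
      ε (f′ *ᵖ g *ᵖ X-1)         ≡⟨ ε-* (f′ *ᵖ g) X-1 ⟩
      ε (f′ *ᵖ g) * 0ℤ           ≡⟨ ℤ.*-zeroʳ (ε (f′ *ᵖ g)) ⟩
      0ℤ * + p                   ∎)
      where open ≡-Reasoning
    s′ = proj₁ (ε≡0⇒X-1∣ s εs≡0)
    s≋ = proj₂ (ε≡0⇒X-1∣ s εs≡0)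

  infix 4 _∈⟨_,Φ⟩
  _∈⟨_,Φ⟩ : Poly → Poly → Set
  f ∈⟨ y ,Φ⟩ = ∃₂ λ a b → f ≋ a *ᵖ y +ᵖ b *ᵖ Φ

  ∈⟨1⟩ : ∀ f → f ∈⟨ 1ᵖ ,Φ⟩
  ∈⟨1⟩ f = f , [] , trivial f Φ
    where
    trivial : ∀ f Φ → f ≋ f *ᵖ 1ᵖ +ᵖ [] *ᵖ Φ
    trivial = solve-∀ polySolverRing

  ∈⟨X-1^suc⟩ : ∀ f f′ c k → f ≋ f′ *ᵖ X-1 +ᵖ c *ᵖ Φ → f′ ∈⟨ X-1 ^ᵖ k ,Φ⟩ → f ∈⟨ X-1 ^ᵖ suc k ,Φ⟩
  ∈⟨X-1^suc⟩ f f′ c k f≋ (a , b , f′≋) = a , b *ᵖ X-1 +ᵖ c ,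
    R.trans f≋ (R.trans (R.+-congʳ {c *ᵖ Φ} (R.*-congʳ {X-1} f′≋)) (regroup a (X-1 ^ᵖ k) b Φ X-1 c))
    where
    regroup : ∀ a w b Φ y c → (a *ᵖ w +ᵖ b *ᵖ Φ) *ᵖ y +ᵖ c *ᵖ Φ ≋ a *ᵖ (y *ᵖ w) +ᵖ (b *ᵖ y +ᵖ c) *ᵖ Φ
    regroup = solve-∀ polySolverRing

  -- Each step lowers k or l, according to which of f(1) and g(1) is divisible by p. The two targets
  -- are separate because the power needed to conclude depends on the size of the individual factor.
  ∣*⇒∈⟨X-1^⟩ : ∀ k l f g → Φ ∣ₚ f *ᵖ g → f ∈⟨ X-1 ^ᵖ k ,Φ⟩ ⊎ g ∈⟨ X-1 ^ᵖ l ,Φ⟩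
  ∣*⇒∈⟨X-1^⟩ zero l f g _ = inj₁ (∈⟨1⟩ f)
  ∣*⇒∈⟨X-1^⟩ (suc k) zero f g _ = inj₂ (∈⟨1⟩ g)
  ∣*⇒∈⟨X-1^⟩ (suc k) (suc l) f g Φ∣fg@(r , e)
    with euclidsLemmaℤ pr (ε f) (ε g) (ℤ∣.divides (ε r)
           (trans (sym (ε-* f g)) (trans (sym (ε-cong e)) (trans (ε-* r Φ) (cong (ε r *_) ε-Φ)))))
  ... | inj₁ p∣εf = let f′ , c , f≋ , Φ∣f′g = splitOff f g p∣εf Φ∣fg in
    Sum.map₁ (∈⟨X-1^suc⟩ f f′ c k f≋) (∣*⇒∈⟨X-1^⟩ k (suc l) f′ g Φ∣f′g)
  ... | inj₂ p∣εg = let g′ , c , g≋ , Φ∣g′f = splitOff g f p∣εg (r , R.trans e (R.*-comm f g))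
                        s , e′ = Φ∣g′f in
    Sum.map₂ (∈⟨X-1^suc⟩ g g′ c l g≋) (∣*⇒∈⟨X-1^⟩ (suc k) l f g′ (s , R.trans e′ (R.*-comm g′ f)))

  [X-1^d]^∈⟨p^⟩ : ∀ m → (X-1 ^ᵖ d) ^ᵖ m ∈⟨ [ + p ] ^ᵖ m ,Φ⟩
  [X-1^d]^∈⟨p^⟩ zero = 1ᵖ , [] , trivial Φ
    where
    trivial : ∀ Φ → 1ᵖ ≋ 1ᵖ *ᵖ 1ᵖ +ᵖ [] *ᵖ Φ
    trivial = solve-∀ polySolverRing
  [X-1^d]^∈⟨p^⟩ (suc m) = let a , b , e = [X-1^d]^∈⟨p^⟩ m in
    A *ᵖ a , [ + p ] *ᵖ A *ᵖ b +ᵖ B *ᵖ (a *ᵖ [ + p ] ^ᵖ m +ᵖ b *ᵖ Φ) ,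
    R.trans (R.*-cong X-1^d e) (expand [ + p ] A B Φ a ([ + p ] ^ᵖ m) b)
    where
    expand : ∀ c A B Φ a w b → (c *ᵖ A +ᵖ B *ᵖ Φ) *ᵖ (a *ᵖ w +ᵖ b *ᵖ Φ) ≋
      A *ᵖ a *ᵖ (c *ᵖ w) +ᵖ (c *ᵖ A *ᵖ b +ᵖ B *ᵖ (a *ᵖ w +ᵖ b *ᵖ Φ)) *ᵖ Φ
    expand = solve-∀ polySolverRing

  ∈⟨X-1^⟩⇒∈⟨p^⟩ : ∀ m f → f ∈⟨ X-1 ^ᵖ (d ℕ.* m) ,Φ⟩ → f ∈⟨ [ + p ] ^ᵖ m ,Φ⟩
  ∈⟨X-1^⟩⇒∈⟨p^⟩ m f (a , b , f≋) = let a′ , b′ , e = [X-1^d]^∈⟨p^⟩ m in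
    a *ᵖ a′ , a *ᵖ b′ +ᵖ b , (begin
    f                                                       ≈⟨ f≋ ⟩
    a *ᵖ X-1 ^ᵖ (d ℕ.* m) +ᵖ b *ᵖ Φ                         ≈⟨ R.+-congʳ {b *ᵖ Φ} (R.*-congˡ {a} (R.trans (R.sym (^ᵖ-assocʳ X-1 d m)) e)) ⟩
    a *ᵖ (a′ *ᵖ [ + p ] ^ᵖ m +ᵖ b′ *ᵖ Φ) +ᵖ b *ᵖ Φ          ≈⟨ regroup a a′ ([ + p ] ^ᵖ m) b′ Φ b ⟩
    a *ᵖ a′ *ᵖ [ + p ] ^ᵖ m +ᵖ (a *ᵖ b′ +ᵖ b) *ᵖ Φ          ∎)
    where
    open ≋-Reasoning
    regroup : ∀ a c w d Φ b → a *ᵖ (c *ᵖ w +ᵖ d *ᵖ Φ) +ᵖ b *ᵖ Φ ≋ a *ᵖ c *ᵖ w +ᵖ (a *ᵖ d +ᵖ b) *ᵖ Φ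
    regroup = solve-∀ polySolverRing

  -- The exponent depends on f alone. Multiplying by B replaces reduction modulo Φ by reduction
  -- modulo x ^ n - 1 = B Φ, where normal forms are available: the residue of f B is divisible by p
  -- ^ m but too small for that unless it is 0. So B Φ divides f B, and B cancels.
  ∈⟨p^⟩⇒∣ : ∀ f → ∃ λ m → f ∈⟨ [ + p ] ^ᵖ m ,Φ⟩ → Φ ∣ₚ f
  ∈⟨p^⟩⇒∣ f = m , λ (a , b , f≋) → divisible a b f≋
    where
    w  = proj₁ (residue n (f *ᵖ B))
    w≋ = proj₂ (residue n (f *ᵖ B))
    -- Because m < p ^ m, a bound on the coefficients can itself serve as the exponent.
    m  = sumAbs w n
    module _ (a b : Poly) (f≋ : f ≋ a *ᵖ [ + p ] ^ᵖ m +ᵖ b *ᵖ Φ) where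
      c  = + (p ^ m)
      w′  = proj₁ (residue n (a *ᵖ B))
      w′≋ = proj₂ (residue n (a *ᵖ B))
      regroup : ∀ a c b Φ B → (a *ᵖ c +ᵖ b *ᵖ Φ) *ᵖ B ≋ c *ᵖ (a *ᵖ B) +ᵖ b *ᵖ (B *ᵖ Φ)
      regroup = solve-∀ polySolverRing
      fB≋ : f *ᵖ B ≋ [ c ] *ᵖ (a *ᵖ B) ⟨mod X^n-1 n ⟩
      fB≋ = b , (begin
        f *ᵖ B                                           ≈⟨ R.*-congʳ {B} f≋ ⟩
        (a *ᵖ [ + p ] ^ᵖ m +ᵖ b *ᵖ Φ) *ᵖ B               ≈⟨ regroup a ([ + p ] ^ᵖ m) b Φ B ⟩
        [ + p ] ^ᵖ m *ᵖ (a *ᵖ B) +ᵖ b *ᵖ (B *ᵖ Φ)        ≈⟨ R.+-cong (R.*-congʳ {a *ᵖ B} ([+]^ p m)) (R.*-congˡ {b} B*Φ) ⟩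
        [ c ] *ᵖ (a *ᵖ B) +ᵖ b *ᵖ X^n-1 n                ∎)
        where open ≋-Reasoning
      scale : [ c ] *ᵖ applyUpTo w′ n ≋ applyUpTo (λ i → w′ i * c + 0ℤ) n
      scale = R.trans (R.sym (R.+-identityʳ ([ c ] *ᵖ applyUpTo w′ n)))
        (R.trans (R.+-congˡ {[ c ] *ᵖ applyUpTo w′ n} (R.sym (applyUpTo-0 n)))
          (R.sym (applyUpTo-linear c w′ (const 0ℤ) n)))
      w≡w′c : ∀ i → i ℕ.< n → w i ≡ w′ i * c + 0ℤ
      w≡w′c = applyUpTo-injective-mod n w (λ i → w′ i * c + 0ℤ)
        (mod-trans (mod-sym w≋) (mod-trans fB≋ (mod-trans (mod-*ˡ [ c ] w′≋) (mod-reflexive scale))))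
      w≡0 : ∀ i → i ℕ.< n → w i ≡ 0ℤ
      w≡0 i i<n = ∣∧small⇒0 (p ^ m) (w i) (w′ i)
        (ℕ.≤-<-trans (∣∣≤sumAbs w n i i<n) (n<m^n p m (prime>1 pr)))
        (trans (w≡w′c i i<n) (ℤ.+-identityʳ _))
      fB≋0 : f *ᵖ B ≋ [] ⟨mod X^n-1 n ⟩
      fB≋0 = mod-trans w≋ (mod-reflexive
        (R.trans (R.reflexive (applyUpTo-cong w (const 0ℤ) n w≡0)) (applyUpTo-0 n)))
      divisible : Φ ∣ₚ f
      divisible = let k , e = fB≋0 in k , *ᵖ-cancelʳ B≢0 (R.sym (begin
        f *ᵖ B              ≈⟨ e ⟩
        k *ᵖ X^n-1 n        ≈⟨ R.*-congˡ {k} B*Φ ⟨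
        k *ᵖ (B *ᵖ Φ)       ≈⟨ swap k B Φ ⟩
        k *ᵖ Φ *ᵖ B         ∎))
        where
        open ≋-Reasoning
        swap : ∀ a b c → a *ᵖ (b *ᵖ c) ≋ a *ᵖ c *ᵖ b
        swap = solve-∀ polySolverRing

  ∣*⇒∣⊎∣ : ∀ f g → Φ ∣ₚ f *ᵖ g → Φ ∣ₚ f ⊎ Φ ∣ₚ g
  ∣*⇒∣⊎∣ f g Φ∣fg =
    let m , f∣ = ∈⟨p^⟩⇒∣ f
        l , g∣ = ∈⟨p^⟩⇒∣ g
    in Sum.map (f∣ ∘ ∈⟨X-1^⟩⇒∈⟨p^⟩ m f) (g∣ ∘ ∈⟨X-1^⟩⇒∈⟨p^⟩ l g)
         (∣*⇒∈⟨X-1^⟩ (d ℕ.* m) (d ℕ.* l) f g Φ∣fg)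

-- Cyclotomic polynomials at prime powers

prime∤⇒coprime : ∀ {p d} → Prime p → p ∤ d → Coprime d p
prime∤⇒coprime pr p∤d (c∣d , c∣p) with prime⇒irreducible pr c∣p
... | inj₁ c≡1  = c≡1
... | inj₂ refl = ⊥-elim (p∤d c∣d)

∣p^⇒≡p^ : ∀ {p} → Prime p → ∀ n {d} → d ℕ∣.∣ p ^ n → ∃ λ i → i ℕ.≤ n × d ≡ p ^ i
∣p^⇒≡p^ pr zero    d∣1 = 0 , z≤n , ∣1⇒≡1 d∣1
∣p^⇒≡p^ {p} pr (suc n) {d} d∣ with p ∣? d
... | no p∤d = let i , i≤n , e = ∣p^⇒≡p^ pr n (coprime-divisor (prime∤⇒coprime pr p∤d) d∣) in
  i , ℕ.m≤n⇒m≤1+n i≤n , e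
... | yes (divides-refl q) = let i , i≤n , e = ∣p^⇒≡p^ pr n {q} (*-cancelʳ-∣ p {{prime⇒nonZero pr}} (subst (q ℕ.* p ℕ∣.∣_) (ℕ.*-comm p (p ^ n)) d∣)) in
  suc i , s≤s i≤n , trans (cong (ℕ._* p) e) (ℕ.*-comm (p ^ i) p)

p^≢0 : ∀ {p} → Prime p → ∀ i → NonZero (p ^ i)
p^≢0 {p} pr i = ℕ.m^n≢0 p i {{prime⇒nonZero pr}}

^-monoʳ-∣ : ∀ p {i j} → i ℕ.≤ j → p ^ i ℕ∣.∣ p ^ j
^-monoʳ-∣ p {i} {j} i≤j = divides (p ^ (j ∸ i))
  (trans (cong (p ^_) (sym (ℕ.m∸n+n≡m i≤j))) (ℕ.^-distribˡ-+-* p (j ∸ i) i))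

∏Φ-below-∣ : ∀ n k → k ℕ∣.∣ n → ∏Φ-below n (suc k) ≡ ∏Φ-below n k *ᵖ Φ k
∏Φ-below-∣ n k k∣n = cong (λ b → if b then ∏Φ-below n k *ᵖ Φ k else ∏Φ-below n k) (dec-true (k ∣? n) k∣n)

∏Φ-below-∤ : ∀ n k → k ∤ n → ∏Φ-below n (suc k) ≡ ∏Φ-below n k
∏Φ-below-∤ n k k∤n = cong (λ b → if b then ∏Φ-below n k *ᵖ Φ k else ∏Φ-below n k) (dec-false (k ∣? n) k∤n)

∏Φ-below-gap : ∀ n a l → (∀ k → a ℕ.≤ k → k ℕ.< l ℕ.+ a → k ∤ n) → ∏Φ-below n (l ℕ.+ a) ≡ ∏Φ-below n a
∏Φ-below-gap n a zero    gap = refl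
∏Φ-below-gap n a (suc l) gap = trans
  (∏Φ-below-∤ n (l ℕ.+ a) (gap (l ℕ.+ a) (ℕ.m≤n+m a l) ℕ.≤-refl))
  (∏Φ-below-gap n a l λ k a≤k k<l+a → gap k a≤k (ℕ.m≤n⇒m≤1+n k<l+a))

-- `_/ᵖ_` returns whichever quotient the decision procedure finds; by cancellation there is only
-- one.
/ᵖ-exact : ∀ {p q s} → ¬ (p ≋ []) → s *ᵖ p ≋ q → q /ᵖ p ≋ s
/ᵖ-exact {p} {q} {s} p≢0 sp≋q with p ∣ᵖ? q
... | yes (r , rp≈q) = *ᵖ-cancelʳ p≢0 (R.trans (mk≋ rp≈q) (R.sym sp≋q))
... | no p∤q         = ⊥-elim (p∤q (s , at sp≋q))

-- Closed form of `Φ (p ^ i)` for prime p, including Φ₁ = x - 1.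
Ψ : ℕ → ℕ → Poly
Ψ p zero    = X-1
Ψ p (suc i) = geometric (X ^ᵖ (p ^ i)) p

Ψ-telescope : ∀ p i → Ψ p (suc i) *ᵖ X^n-1 (p ^ i) ≋ X^n-1 (p ^ suc i)
Ψ-telescope p i = R.trans (geometric-* (X ^ᵖ (p ^ i)) p) (R.+-congʳ { -ᵖ 1ᵖ}
  (R.trans (^ᵖ-assocʳ X (p ^ i) p) (R.reflexive (cong (X ^ᵖ_) (ℕ.*-comm (p ^ i) p)))))

module _ {p} (pr : Prime p) where

  private instance
    p≢0 : NonZero p
    p≢0 = prime⇒nonZero pr

  no-divisor-between : ∀ i j k → p ^ i ℕ.< k → k ℕ.< p ^ suc i → k ∤ p ^ j
  no-divisor-between i j k p^i<k k<p^ k∣ with ∣p^⇒≡p^ pr j k∣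
  ... | l , _ , refl with l ℕ.≤? i
  ...   | yes l≤i = ℕ.<⇒≱ p^i<k (ℕ.^-monoʳ-≤ p l≤i)
  ...   | no  l≰i = ℕ.<⇒≱ k<p^ (ℕ.^-monoʳ-≤ p (ℕ.≰⇒> l≰i))

  -- The divisors of p ^ j are powers of p, so the running product does not change strictly between
  -- consecutive powers.
  ∏Φ-below-p^ : ∀ i j → ∏Φ-below (p ^ j) (p ^ suc i) ≡ ∏Φ-below (p ^ j) (suc (p ^ i))
  ∏Φ-below-p^ i j = subst (λ k → ∏Φ-below (p ^ j) k ≡ ∏Φ-below (p ^ j) (suc (p ^ i)))
    (ℕ.m∸n+n≡m p^i<p^) (∏Φ-below-gap (p ^ j) (suc (p ^ i)) (p ^ suc i ∸ suc (p ^ i)) λ k p^i<k k< →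
      no-divisor-between i j k p^i<k (subst (k ℕ.<_) (ℕ.m∸n+n≡m p^i<p^) k<))
    where
    p^i<p^ : p ^ i ℕ.< p ^ suc i
    p^i<p^ = ℕ.^-monoʳ-< p (prime>1 pr) (ℕ.n<1+n i)

  -- The running product starts at index 0; the junk value `Φ 0` stays out of it, as 0 does not
  -- divide p ^ j.
  ∏Φ-below-0 : ∀ j → ∏Φ-below (p ^ j) 1 ≡ 1ᵖ
  ∏Φ-below-0 j = ∏Φ-below-∤ (p ^ j) 0 λ 0∣ → ℕ.≢-nonZero⁻¹ (p ^ j) {{p^≢0 pr j}} (0∣⇒≡0 0∣)

  -- The product telescopes by `Ψ-telescope`. The closed form is assumed only up to exponent i, so
  -- that this can be used inside the strong induction that establishes it.
  ∏Φ-below-suc-p^ : ∀ j i → i ℕ.≤ j → (∀ l → l ℕ.≤ i → Φ (p ^ l) ≋ Ψ p l) →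
    ∏Φ-below (p ^ j) (suc (p ^ i)) ≋ X^n-1 (p ^ i)
  ∏Φ-below-suc-p^ j zero i≤j Φ≋Ψ = begin
    ∏Φ-below (p ^ j) 2              ≡⟨ ∏Φ-below-∣ (p ^ j) 1 (1∣ (p ^ j)) ⟩
    ∏Φ-below (p ^ j) 1 *ᵖ Φ 1       ≈⟨ R.*-cong (R.reflexive (∏Φ-below-0 j)) (Φ≋Ψ 0 z≤n) ⟩
    1ᵖ *ᵖ X-1                       ≈⟨ R.trans (R.*-identityˡ X-1) X-1≋X^1-1 ⟩
    X^n-1 1                         ∎
    where open ≋-Reasoning
  ∏Φ-below-suc-p^ j (suc i) i<j Φ≋Ψ = begin
    ∏Φ-below (p ^ j) (suc (p ^ suc i))
      ≡⟨ ∏Φ-below-∣ (p ^ j) (p ^ suc i) (^-monoʳ-∣ p i<j) ⟩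
    ∏Φ-below (p ^ j) (p ^ suc i) *ᵖ Φ (p ^ suc i)
      ≈⟨ R.*-cong (R.trans (R.reflexive (∏Φ-below-p^ i j))
           (∏Φ-below-suc-p^ j i (ℕ.<⇒≤ i<j) λ l l≤i → Φ≋Ψ l (ℕ.m≤n⇒m≤1+n l≤i))) (Φ≋Ψ (suc i) ℕ.≤-refl) ⟩
    X^n-1 (p ^ i) *ᵖ Ψ p (suc i)
      ≈⟨ R.trans (R.*-comm (X^n-1 (p ^ i)) (Ψ p (suc i))) (Ψ-telescope p i) ⟩
    X^n-1 (p ^ suc i)
      ∎
    where open ≋-Reasoning

  Φ[p^]≋Ψ : ∀ l → Φ (p ^ l) ≋ Ψ p l
  Φ[p^]≋Ψ = <-rec (λ l → Φ (p ^ l) ≋ Ψ p l) step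
    where
    1≢0 : ¬ (1ᵖ ≋ [])
    1≢0 (mk≋ e) with () ← e 0
    step : ∀ l → (∀ {i} → i ℕ.< l → Φ (p ^ i) ≋ Ψ p i) → Φ (p ^ l) ≋ Ψ p l
    step zero _ = /ᵖ-exact {∏Φ-below 1 1} {x^[ 1 ]-1} {X-1}
      (λ e → 1≢0 (R.trans (R.sym (R.reflexive (∏Φ-below-0 0))) e))
      (R.trans (R.*-congˡ {X-1} (R.reflexive (∏Φ-below-0 0)))
        (R.trans (R.*-identityʳ X-1) (R.trans X-1≋X^1-1 (R.sym (x^[]-1≋ 1)))))
    step (suc j) rec = /ᵖ-exact {∏Φ-below n n} {x^[ n ]-1} {Ψ p (suc j)}
      (λ e → X^n-1≢0 (p ^ j) {{p^≢0 pr j}} (R.trans (R.sym below) e))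
      (R.trans (R.*-congˡ {Ψ p (suc j)} below) (R.trans (Ψ-telescope p j) (R.sym (x^[]-1≋ n))))
      where
      n = p ^ suc j
      below : ∏Φ-below n n ≋ X^n-1 (p ^ j)
      below = R.trans (R.reflexive (∏Φ-below-p^ j (suc j)))
        (∏Φ-below-suc-p^ (suc j) j (ℕ.n≤1+n j) λ l l≤j → rec (s≤s l≤j))

∣ₚ-trans : ∀ {p q r} → p ∣ₚ q → q ∣ₚ r → p ∣ₚ r
∣ₚ-trans {p} {q} {r} (a , e) (b , f) = b *ᵖ a , R.trans (R.*-assoc b a p) (R.trans (R.*-congˡ {b} e) f)

X^n-1∣X^mn-1 : ∀ {n m} → n ℕ∣.∣ m → X^n-1 n ∣ₚ X^n-1 m
X^n-1∣X^mn-1 {n} (divides c refl) = geometric (X ^ᵖ n) c , R.trans (geometric-* (X ^ᵖ n) c)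
  (R.+-congʳ { -ᵖ 1ᵖ} (R.trans (^ᵖ-assocʳ X n c) (R.reflexive (cong (X ^ᵖ_) (ℕ.*-comm n c)))))

-- Setting y to 1 turns the sum into n. For y = x ^ (p ^ j) and n = p this says that Φ at p ^ (j +
-- 1) is congruent to the constant p modulo x ^ (p ^ j) - 1.
geometric-mod : ∀ y n → ∃ λ h → geometric y n ≋ [ + n ] +ᵖ h *ᵖ (y +ᵖ -ᵖ 1ᵖ)
geometric-mod y zero    = [] , R.sym (R.trans (R.+-identityʳ [ 0ℤ ]) [0]≋[])
geometric-mod y (suc n) = let h , e = geometric-mod y n in [ + n ] +ᵖ y *ᵖ h , (begin
  1ᵖ +ᵖ y *ᵖ geometric y n                                   ≈⟨ R.+-congˡ {1ᵖ} (R.*-congˡ {y} e) ⟩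
  1ᵖ +ᵖ y *ᵖ ([ + n ] +ᵖ h *ᵖ (y +ᵖ -ᵖ 1ᵖ))                  ≈⟨ regroup y [ + n ] h ⟩
  1ᵖ +ᵖ [ + n ] +ᵖ ([ + n ] +ᵖ y *ᵖ h) *ᵖ (y +ᵖ -ᵖ 1ᵖ)       ∎)
  where
  open ≋-Reasoning
  regroup : ∀ y c h → 1ᵖ +ᵖ y *ᵖ (c +ᵖ h *ᵖ (y +ᵖ -ᵖ 1ᵖ)) ≋ 1ᵖ +ᵖ c +ᵖ (c +ᵖ y *ᵖ h) *ᵖ (y +ᵖ -ᵖ 1ᵖ)
  regroup = solve-∀ polySolverRing

module _ {p} (pr : Prime p) (j : ℕ) where

  private
    q = p ^ suc j
    instance
      p^j≢0 : NonZero (p ^ j)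
      p^j≢0 = p^≢0 pr j
      q≢0 : NonZero q
      q≢0 = p^≢0 pr (suc j)

  ε-Φ[p^] : ε (Φ q) ≡ + p
  ε-Φ[p^] = trans (ε-cong (Φ[p^]≋Ψ pr (suc j))) (ε-geometric (X ^ᵖ (p ^ j)) p (ε-X^ (p ^ j)))

  X^n-1*Φ[p^] : X^n-1 (p ^ j) *ᵖ Φ q ≋ X^n-1 q
  X^n-1*Φ[p^] = R.trans (R.*-comm (X^n-1 (p ^ j)) (Φ q))
    (R.trans (R.*-congʳ {X^n-1 (p ^ j)} (Φ[p^]≋Ψ pr (suc j))) (Ψ-telescope p j))

  Φ[p^]∣X^n-1 : Φ q ∣ₚ X^n-1 q
  Φ[p^]∣X^n-1 = X^n-1 (p ^ j) , X^n-1*Φ[p^]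

  -- Here B = x ^ (p ^ j) - 1 and n = d = q: `frobenius` writes (x - 1) ^ q as x ^ q - 1 plus a
  -- multiple of p, and x ^ q - 1 = B Φ.
  Φ[p^]-prime : ∀ f g → Φ q ∣ₚ f *ᵖ g → Φ q ∣ₚ f ⊎ Φ q ∣ₚ g
  Φ[p^]-prime = Primality.∣*⇒∣⊎∣ pr (Φ q) (X^n-1 (p ^ j)) (proj₁ frob) q q ε-Φ[p^] X^n-1*Φ[p^]
    (R.trans (proj₂ frob) (R.trans (R.+-comm (X^n-1 q) ([ + p ] *ᵖ proj₁ frob))
      (R.+-congˡ {[ + p ] *ᵖ proj₁ frob} (R.sym X^n-1*Φ[p^]))))
    where frob = frobenius pr X (suc j)

  -- A degree argument: r Φ = p would give r (x ^ q - 1) = p (x ^ (p ^ j) - 1), whose right side has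
  -- degree below q; then r = 0 and p = 0.
  Φ[p^]∤[p] : ¬ (Φ q ∣ₚ [ + p ])
  Φ[p^]∤[p] (r , e) = [p]≢0 (begin
    [ + p ]       ≈⟨ e ⟨
    r *ᵖ Φ q      ≈⟨ R.*-congʳ {Φ q} r≋0 ⟩
    []            ∎)
    where
    open ≋-Reasoning
    [p]≢0 : ¬ ([ + p ] ≋ [])
    [p]≢0 (mk≋ z) = ℕ.≢-nonZero⁻¹ p {{prime⇒nonZero pr}} (ℤ.+-injective (z 0))
    regroup : ∀ r B Φ → r *ᵖ (B *ᵖ Φ) ≋ r *ᵖ Φ *ᵖ B
    regroup = solve-∀ polySolverRing
    r* : r *ᵖ X^n-1 q ≋ [ + p ] *ᵖ X^n-1 (p ^ j)
    r* = begin
      r *ᵖ X^n-1 q                    ≈⟨ R.*-congˡ {r} X^n-1*Φ[p^] ⟨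
      r *ᵖ (X^n-1 (p ^ j) *ᵖ Φ q)     ≈⟨ regroup r (X^n-1 (p ^ j)) (Φ q) ⟩
      r *ᵖ Φ q *ᵖ X^n-1 (p ^ j)       ≈⟨ R.*-congʳ {X^n-1 (p ^ j)} e ⟩
      [ + p ] *ᵖ X^n-1 (p ^ j)        ∎
    vanishes : ∀ n .{{_ : NonZero n}} → VanishesFrom (suc n) (X^n-1 n)
    vanishes (suc n) = X^n-1-vanishes n
    r≋0 : r ≋ []
    r≋0 = X^n-1-multiple-small⇒0 q r λ i q≤i → trans (at r* i)
      (trans (coeff-[]*ᵖ (+ p) (X^n-1 (p ^ j)) i) (trans
        (cong (+ p *_) (vanishes (p ^ j) i
          (ℕ.≤-trans (ℕ.^-monoʳ-< p (prime>1 pr) (ℕ.n<1+n j)) q≤i)))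
        (ℤ.*-zeroʳ (+ p))))

Φ-prime : ∀ {n} → IsPrimePower n → ∀ f g → Φ n ∣ₚ f *ᵖ g → Φ n ∣ₚ f ⊎ Φ n ∣ₚ g
Φ-prime (p , suc j , pr , _ , refl) = Φ[p^]-prime pr j

ε-Φ : ∀ {n} → ((p , _) : IsPrimePower n) → ε (Φ n) ≡ + p
ε-Φ (p , suc j , pr , _ , refl) = ε-Φ[p^] pr j

∣ₚ⇒ε∣ε : ∀ {p q a b} → p ∣ₚ q → ε p ≡ + a → ε q ≡ + b → a ℕ∣.∣ b
∣ₚ⇒ε∣ε {p} {q} {a} {b} (r , e) εp≡a εq≡b = divides ∣ ε r ∣ (begin
  b                     ≡⟨ cong ∣_∣ εq≡b ⟨
  ∣ ε q ∣               ≡⟨ cong ∣_∣ (ε-cong e) ⟨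
  ∣ ε (r *ᵖ p) ∣        ≡⟨ cong ∣_∣ (trans (ε-* r p) (cong (ε r *_) εp≡a)) ⟩
  ∣ ε r * + a ∣         ≡⟨ ℤ.abs-* (ε r) (+ a) ⟩
  ∣ ε r ∣ ℕ.* a         ∎)
  where open ≡-Reasoning

Φ∤1 : ∀ {n} → IsPrimePower n → ¬ (Φ n ∣ₚ 1ᵖ)
Φ∤1 pp@(p , _ , pr , _) Φ∣1 = ¬prime[1] (subst Prime (∣1⇒≡1 (∣ₚ⇒ε∣ε Φ∣1 (ε-Φ pp) refl)) pr)

-- Values at 1 rule out different primes. For the same prime, Φₘ divides x ^ (p ^ j) - 1, modulo
-- which Φₙ is the constant p; so Φₘ would divide p.
Φ∤Φ : ∀ {m n} → IsPrimePower m → IsPrimePower n → m ℕ.< n → ¬ (Φ m ∣ₚ Φ n)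
Φ∤Φ pm@(p , suc i , pr , _ , refl) pn@(r , suc j , pr′ , _ , refl) m<n Φm∣Φn
  with prime⇒irreducible pr′ (∣ₚ⇒ε∣ε Φm∣Φn (ε-Φ pm) (ε-Φ pn))
... | inj₁ refl = ¬prime[1] pr
... | inj₂ refl = Φ[p^]∤[p] pr i (combine Φm∣Φn Φm∣X^-1 (geometric-mod (X ^ᵖ (p ^ j)) p))
  where
  i<j : i ℕ.< j
  i<j = ℕ.≰⇒> λ j≤i → ℕ.<⇒≱ m<n (ℕ.^-monoʳ-≤ p {{prime⇒nonZero pr}} (s≤s j≤i))
  Φm∣X^-1 : Φ (p ^ suc i) ∣ₚ X^n-1 (p ^ j)
  Φm∣X^-1 = ∣ₚ-trans (Φ[p^]∣X^n-1 pr i) (X^n-1∣X^mn-1 (^-monoʳ-∣ p i<j))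
  combine : Φ (p ^ suc i) ∣ₚ Φ (p ^ suc j) → Φ (p ^ suc i) ∣ₚ X^n-1 (p ^ j) →
    (∃ λ h → Ψ p (suc j) ≋ [ + p ] +ᵖ h *ᵖ X^n-1 (p ^ j)) → Φ (p ^ suc i) ∣ₚ [ + p ]
  combine (a , e) (b , f) (h , g) = a +ᵖ -ᵖ (h *ᵖ b) , (begin
    (a +ᵖ -ᵖ (h *ᵖ b)) *ᵖ F                                   ≈⟨ expand a h b F ⟩
    a *ᵖ F +ᵖ -ᵖ (h *ᵖ (b *ᵖ F))                              ≈⟨ R.+-cong (R.trans e (R.trans (Φ[p^]≋Ψ pr (suc j)) g)) (R.-‿cong (R.*-congˡ {h} f)) ⟩
    [ + p ] +ᵖ h *ᵖ X^n-1 (p ^ j) +ᵖ -ᵖ (h *ᵖ X^n-1 (p ^ j))  ≈⟨ cancel [ + p ] (h *ᵖ X^n-1 (p ^ j)) ⟩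
    [ + p ]                                                   ∎)
    where
    open ≋-Reasoning
    F = Φ (p ^ suc i)
    expand : ∀ a h b F → (a +ᵖ -ᵖ (h *ᵖ b)) *ᵖ F ≋ a *ᵖ F +ᵖ -ᵖ (h *ᵖ (b *ᵖ F))
    expand = solve-∀ polySolverRing
    cancel : ∀ c d → c +ᵖ d +ᵖ -ᵖ d ≋ c
    cancel = solve-∀ polySolverRing

-- Products of cyclotomic polynomials at distinct prime powers

∏Φ : List ℕ → Poly
∏Φ ns = productᵖ (map Φ ns)

Φ∤∏Φ : ∀ {n ns} → IsPrimePower n → All IsPrimePower ns → All (n ℕ.<_) ns → ¬ (Φ n ∣ₚ ∏Φ ns)
Φ∤∏Φ pp []         []         Φ∣ = Φ∤1 pp Φ∣
Φ∤∏Φ {n} {m ∷ ms} pp (pm ∷ pms) (n<m ∷ n<ms) Φ∣ with Φ-prime pp (Φ m) (∏Φ ms) Φ∣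
... | inj₁ Φn∣Φm = Φ∤Φ pp pm n<m Φn∣Φm
... | inj₂ Φn∣∏  = Φ∤∏Φ pp pms n<ms Φn∣∏

-- Write f = w ∏ with ∏ the product over the tail. The prime Φₙ divides w ∏ but not ∏, so it divides
-- w. The ascending order supplies the inequality m < n that `Φ∤Φ` asks for.
∏Φ-∣ : ∀ {f ns} → AllPairs ℕ._<_ ns → All IsPrimePower ns → All (λ n → Φ n ∣ₚ f) ns → ∏Φ ns ∣ₚ f
∏Φ-∣ {f} []          []        []         = f , R.*-identityʳ f
∏Φ-∣ {f} {n ∷ ns} (n<ns ∷ <ns) (pp ∷ pps) (Φ∣f ∷ Φs∣f) with ∏Φ-∣ {f} {ns} <ns pps Φs∣f
... | w , w∏≋f with Φ-prime pp w (∏Φ ns) (proj₁ Φ∣f , R.trans (proj₂ Φ∣f) (R.sym w∏≋f))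
...   | inj₂ Φ∣∏       = ⊥-elim (Φ∤∏Φ pp pps n<ns Φ∣∏)
...   | inj₁ (v , vΦ≋w) = v , R.trans (R.sym (R.*-assoc v (Φ n) (∏Φ ns))) (R.trans (R.*-congʳ {∏Φ ns} vΦ≋w) w∏≋f)

Φ∣geometric : ∀ {n P} → IsPrimePower n → n ℕ∣.∣ P → Φ n ∣ₚ geometric X P
Φ∣geometric {P = P} (p , suc j , pr , _ , refl) n∣P =
  let h , e = X^n-1∣X^mn-1 n∣P in h *ᵖ g , *ᵖ-cancelʳ X-1≢0 (begin
  h *ᵖ g *ᵖ Φ n *ᵖ X-1               ≈⟨ regroup h g (Φ n) X-1 ⟩
  h *ᵖ ((g *ᵖ X-1) *ᵖ Φ n)           ≈⟨ R.*-congˡ {h} (R.*-congʳ {Φ n} (geometric-* X (p ^ j))) ⟩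
  h *ᵖ (X^n-1 (p ^ j) *ᵖ Φ n)        ≈⟨ R.*-congˡ {h} (X^n-1*Φ[p^] pr j) ⟩
  h *ᵖ X^n-1 n                       ≈⟨ e ⟩
  X^n-1 P                            ≈⟨ geometric-* X P ⟨
  geometric X P *ᵖ X-1               ∎)
  where
  open ≋-Reasoning
  n = p ^ suc j
  g = geometric X (p ^ j)
  regroup : ∀ h g F x → h *ᵖ g *ᵖ F *ᵖ x ≋ h *ᵖ ((g *ᵖ x) *ᵖ F)
  regroup = solve-∀ polySolverRing

-- Prime power divisors

∏Φ-↭ : ∀ {ms ns} → ms ↭ ns → ∏Φ ms ≋ ∏Φ ns
∏Φ-↭ ↭.refl                 = R.refl
∏Φ-↭ (↭.prep n r)           = R.*-congˡ {Φ n} (∏Φ-↭ r)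
∏Φ-↭ (↭.swap {ms} {ns} m n r) = R.trans (exchange (Φ m) (Φ n) (∏Φ ms)) (R.*-congˡ {Φ n} (R.*-congˡ {Φ m} (∏Φ-↭ r)))
  where
  exchange : ∀ a b c → a *ᵖ (b *ᵖ c) ≋ b *ᵖ (a *ᵖ c)
  exchange = solve-∀ polySolverRing
∏Φ-↭ (↭.trans r s)          = R.trans (∏Φ-↭ r) (∏Φ-↭ s)

module _ {A B C : ℕ → Set} (a? : Decidable A) (b? : Decidable B) (c? : Decidable C)
  (c⇒a⊎b : ∀ {n} → C n → A n ⊎ B n) (a⇒c : ∀ {n} → A n → C n) (b⇒c : ∀ {n} → B n → C n)
  (disjoint : ∀ {n} → A n → B n → ⊥) where

  private
    filterA = ∏Φ ∘ filter a?
    filterB = ∏Φ ∘ filter b?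
    filterC = ∏Φ ∘ filter c?

  ∏Φ-filter-⊎ : ∀ ns → ∏Φ (filter a? ns) *ᵖ ∏Φ (filter b? ns) ≋ ∏Φ (filter c? ns)
  ∏Φ-filter-⊎ []       = R.*-identityˡ 1ᵖ
  ∏Φ-filter-⊎ (n ∷ ns) with c? n
  ... | no ¬c = R.trans
    (R.*-cong (R.reflexive (cong ∏Φ (filter-reject a? (¬c ∘ a⇒c)))) (R.reflexive (cong ∏Φ (filter-reject b? (¬c ∘ b⇒c)))))
    (∏Φ-filter-⊎ ns)
  ... | yes c with c⇒a⊎b c
  ...   | inj₁ a = R.trans
    (R.*-cong (R.reflexive (cong ∏Φ (filter-accept a? a))) (R.reflexive (cong ∏Φ (filter-reject b? (disjoint a)))))
    (R.trans (R.*-assoc (Φ n) (filterA ns) (filterB ns)) (R.*-congˡ {Φ n} (∏Φ-filter-⊎ ns)))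
  ...   | inj₂ b = R.trans
    (R.*-cong (R.reflexive (cong ∏Φ (filter-reject a? λ a → disjoint a b))) (R.reflexive (cong ∏Φ (filter-accept b? b))))
    (R.trans (exchange (filterA ns) (Φ n) (filterB ns)) (R.*-congˡ {Φ n} (∏Φ-filter-⊎ ns)))
    where
    exchange : ∀ a b c → a *ᵖ (b *ᵖ c) ≋ b *ᵖ (a *ᵖ c)
    exchange = solve-∀ polySolverRing

PrimePowerDivisor : ℕ → ℕ → Set
PrimePowerDivisor P n = n ℕ∣.∣ P × IsPrimePower n

primePowerDivisor? : ∀ P n → Dec (PrimePowerDivisor P n)
primePowerDivisor? P n = (n ∣? P) ×-dec isPrimePower? n

-- This determines the list up to permutation. The product of the Φₙ can therefore be computed on
-- whichever list is convenient: the ascending filter, one that follows the factorisation of P, or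
-- the powers of a single prime.
ListsPrimePowerDivisors : ℕ → List ℕ → Set
ListsPrimePowerDivisors P ns = Unique ns × ∀ n → n ∈ ns ⇔ PrimePowerDivisor P n

primePowerDivisors-↭ : ∀ {P ms ns} →
  ListsPrimePowerDivisors P ms → ListsPrimePowerDivisors P ns → ms ↭ ns
primePowerDivisors-↭ (um , em) (un , en) = ∼bag⇒↭ (unique∧set⇒bag um un λ {n} →
  mk⇔ (Equivalence.from (en n) ∘ Equivalence.to (em n)) (Equivalence.from (em n) ∘ Equivalence.to (en n)))

filter-primePowerDivisors : ∀ P .{{_ : NonZero P}} →
  ListsPrimePowerDivisors P (filter (primePowerDivisor? P) (upTo (suc P)))
filter-primePowerDivisors P = Unique.filter⁺ (primePowerDivisor? P) (Unique.upTo⁺ (suc P)) , λ n → mk⇔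
  (proj₂ ∘ ∈-filter⁻ (primePowerDivisor? P) {xs = upTo (suc P)})
  (λ d → ∈-filter⁺ (primePowerDivisor? P) (∈-upTo⁺ (s≤s (∣⇒≤ (proj₁ d)))) d)

primePower-coprime-divisor : ∀ {p r} → Prime p → Prime r → p ≢ r → ∀ j m → r ^ j ℕ∣.∣ p ℕ.* m → r ^ j ℕ∣.∣ m
primePower-coprime-divisor {p} {r} pr pr′ p≢r j m = coprime-divisor (prime∤⇒coprime pr p∤r^j)
  where
  p∤r^j : p ∤ r ^ j
  p∤r^j p∣ with ∣p^⇒≡p^ pr′ j p∣
  ... | zero  , _ , p≡1   = ¬prime[1] (subst Prime p≡1 pr)
  ... | suc i , _ , p≡r*  with prime⇒irreducible pr (divides (r ^ i) (trans p≡r* (ℕ.*-comm r (r ^ i))))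
  ...   | inj₁ r≡1 = ¬prime[1] (subst Prime r≡1 pr′)
  ...   | inj₂ r≡p = p≢r (sym r≡p)

-- The search descends from exponent m, which is too large because m < p ^ m, to the first power
-- that divides.
valuation : ∀ {p} → Prime p → ∀ m .{{_ : NonZero m}} → ∃ λ a → p ^ a ℕ∣.∣ m × p ^ suc a ∤ m
valuation {p} pr m = search m λ p^m∣m → ℕ.<⇒≱ (n<m^n p m (prime>1 pr)) (∣⇒≤ p^m∣m)
  where
  search : ∀ k → p ^ k ∤ m → ∃ λ a → p ^ a ℕ∣.∣ m × p ^ suc a ∤ m
  search zero    p^0∤m = ⊥-elim (p^0∤m (1∣ m))
  search (suc k) p^∤m with p ^ k ∣? m
  ... | yes p^k∣m = k , p^k∣m , p^∤m
  ... | no  p^k∤m = search k p^k∤m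

-- Passing from m to p m adds the single prime power p ^ (a + 1), where a is
-- the exponent of p in m.
∏Φ-primePowerDivisors : ∀ ps → All Prime ps →
  ∃ λ ns → ListsPrimePowerDivisors (product ps) ns × ε (∏Φ ns) ≡ + product ps
∏Φ-primePowerDivisors []       []         = [] , ([] , λ n → mk⇔ (λ ()) λ (n∣1 , pp) → ⊥-elim (pp∤1 pp n∣1)) , refl
  where
  pp∤1 : ∀ {n} → IsPrimePower n → n ∤ 1
  pp∤1 (p , suc j , pr , _ , refl) n∣1 = ℕ.<⇒≱ (ℕ.≤-trans (prime>1 pr) (ℕ.m≤m*n p (p ^ j) {{p^≢0 pr j}})) (∣⇒≤ n∣1)
∏Φ-primePowerDivisors (p ∷ ps) (pr ∷ prs)
  with ∏Φ-primePowerDivisors ps prs | valuation pr (product ps) {{product≢0 prs}}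
  where
  product≢0 : ∀ {ps} → All Prime ps → NonZero (product ps)
  product≢0 []         = _
  product≢0 {p ∷ ps} (pr ∷ prs) = ℕ.m*n≢0 p (product ps) {{prime⇒nonZero pr}} {{product≢0 prs}}
... | ns , (un , en) , e | a , p^a∣m , p^∤m = n₀ ∷ ns , (n₀∉ns ∷ un , λ n → mk⇔ to from) , (begin
  ε (Φ n₀ *ᵖ ∏Φ ns)         ≡⟨ ε-* (Φ n₀) (∏Φ ns) ⟩
  ε (Φ n₀) * ε (∏Φ ns)      ≡⟨ cong₂ _*_ (ε-Φ[p^] pr a) e ⟩
  + p * + m                 ≡⟨ ℤ.pos-* p m ⟨
  + (p ℕ.* m)               ∎)
  where
  open ≡-Reasoning
  m  = product ps
  n₀ = p ^ suc a
  n₀∉ns : All (n₀ ≢_) ns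
  n₀∉ns = All.tabulate λ {n} n∈ns n₀≡n → p^∤m (subst (ℕ∣._∣ m) (sym n₀≡n) (proj₁ (Equivalence.to (en n) n∈ns)))
  to : ∀ {n} → n ∈ n₀ ∷ ns → PrimePowerDivisor (p ℕ.* m) n
  to (here refl)      = *-monoʳ-∣ p p^a∣m , p , suc a , pr , s≤s z≤n , refl
  to {n} (there n∈ns) = let n∣m , pp = Equivalence.to (en n) n∈ns in ∣-trans n∣m (n∣m*n p) , pp
  from : ∀ {n} → PrimePowerDivisor (p ℕ.* m) n → n ∈ n₀ ∷ ns
  from {n} (n∣pm , pp) with n ∣? m
  ... | yes n∣m = there (Equivalence.from (en n) (n∣m , pp))
  from {n} (n∣pm , (r , suc j , pr′ , _ , refl)) | no n∤m with p ℕ.≟ r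
  ...   | no p≢r = ⊥-elim (n∤m (primePower-coprime-divisor pr pr′ p≢r (suc j) m n∣pm))
  -- p ^ (j + 1) divides p m, so p ^ j divides m and j ≤ a; it does not divide m, so j ≥ a.
  ...   | yes refl = here (cong (λ i → p ^ suc i) (ℕ.≤-antisym {j} {a}
    (ℕ.≮⇒≥ λ a<j → p^∤m (∣-trans (^-monoʳ-∣ p a<j) (*-cancelˡ-∣ p {{prime⇒nonZero pr}} n∣pm)))
    (ℕ.≮⇒≥ λ j<a → n∤m (∣-trans (^-monoʳ-∣ p j<a) p^a∣m))))

module _ {p} (pr : Prime p) where

  -- Listed from the top power down, so that passing from t to t + 1 adds a factor in front and the
  -- product telescopes.
  primePowers : ℕ → List ℕ
  primePowers = applyDownFrom (λ i → p ^ suc i)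

  primePowers-divisors : ∀ t → ListsPrimePowerDivisors (p ^ t) (primePowers t)
  primePowers-divisors t = Unique.applyDownFrom⁺₁ _ t distinct , λ n → mk⇔ to from
    where
    distinct : ∀ {i j} → j ℕ.< i → i ℕ.< t → p ^ suc i ≢ p ^ suc j
    distinct j<i _ = ≢-sym (ℕ.<⇒≢ (ℕ.^-monoʳ-< p (prime>1 pr) (s≤s j<i)))
    to : ∀ {n} → n ∈ primePowers t → PrimePowerDivisor (p ^ t) n
    to n∈ with ∈-applyDownFrom⁻ (λ i → p ^ suc i) n∈
    ... | i , i<t , refl = ^-monoʳ-∣ p i<t , p , suc i , pr , s≤s z≤n , refl
    from : ∀ {n} → PrimePowerDivisor (p ^ t) n → n ∈ primePowers t
    from {n} (n∣p^t , pp) with ∣p^⇒≡p^ pr t n∣p^t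
    from (_ , r , suc j , pr′ , _ , r^≡1) | zero , _ , n≡1 =
      ⊥-elim (ℕ.<⇒≢ (ℕ.≤-trans (prime>1 pr′) (ℕ.m≤m*n r (r ^ j) {{p^≢0 pr′ j}})) (trans (sym n≡1) r^≡1))
    from _ | suc i , i<t , refl = ∈-applyDownFrom⁺ (λ i → p ^ suc i) i<t

  ∏Φ-primePowers : ∀ t → ∏Φ (primePowers t) *ᵖ X-1 ≋ X^n-1 (p ^ t)
  ∏Φ-primePowers zero    = R.trans (R.*-identityˡ X-1) X-1≋X^1-1
  ∏Φ-primePowers (suc t) = begin
    Φ (p ^ suc t) *ᵖ ∏Φ (primePowers t) *ᵖ X-1      ≈⟨ R.*-assoc (Φ (p ^ suc t)) _ X-1 ⟩
    Φ (p ^ suc t) *ᵖ (∏Φ (primePowers t) *ᵖ X-1)    ≈⟨ R.*-congˡ {Φ (p ^ suc t)} (∏Φ-primePowers t) ⟩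
    Φ (p ^ suc t) *ᵖ X^n-1 (p ^ t)                  ≈⟨ R.*-comm (Φ (p ^ suc t)) _ ⟩
    X^n-1 (p ^ t) *ᵖ Φ (p ^ suc t)                  ≈⟨ X^n-1*Φ[p^] pr t ⟩
    X^n-1 (p ^ suc t)                               ∎
    where open ≋-Reasoning

-- Multitilings and tilings

NonNegative : Poly → Set
NonNegative p = ∀ i → 0ℤ ≤ coeff p i

0≤* : ∀ {i j} → 0ℤ ≤ i → 0ℤ ≤ j → 0ℤ ≤ i * j
0≤* {+ m} {+ n} _ _ = subst (0ℤ ≤_) (ℤ.pos-* m n) (+≤+ z≤n)

NonNegative-cong : ∀ {p q} → p ≋ q → NonNegative p → NonNegative q
NonNegative-cong e nn i = subst (0ℤ ≤_) (at e i) (nn i)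

+ᵖ-nonNegative : ∀ {p q} → NonNegative p → NonNegative q → NonNegative (p +ᵖ q)
+ᵖ-nonNegative {p} {q} np nq i = subst (0ℤ ≤_) (sym (coeff-+ᵖ p q i)) (ℤ.+-mono-≤ (np i) (nq i))

*ᵖ-nonNegative : ∀ {p q} → NonNegative p → NonNegative q → NonNegative (p *ᵖ q)
*ᵖ-nonNegative {p} {q} np nq zero    = subst (0ℤ ≤_) (sym (coeff-*ᵖ-zero p q)) (0≤* (np 0) (nq 0))
*ᵖ-nonNegative {p} {q} np nq (suc i) = subst (0ℤ ≤_) (sym (coeff-*ᵖ-suc p q i))
  (ℤ.+-mono-≤ (0≤* (np 0) (nq (suc i)))
    (*ᵖ-nonNegative {tl p} {q} (λ j → subst (0ℤ ≤_) (sym (coeff-tl p j)) (np (suc j))) nq i))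

1ᵖ-nonNegative : NonNegative 1ᵖ
1ᵖ-nonNegative zero    = +≤+ z≤n
1ᵖ-nonNegative (suc i) = ℤ.≤-refl

X^-nonNegative : ∀ n → NonNegative (X ^ᵖ n)
X^-nonNegative zero    = 1ᵖ-nonNegative
X^-nonNegative (suc n) = *ᵖ-nonNegative {X} {X ^ᵖ n} (λ { zero → ℤ.≤-refl ; (suc i) → 1ᵖ-nonNegative i }) (X^-nonNegative n)

geometric-nonNegative : ∀ {y} n → NonNegative y → NonNegative (geometric y n)
geometric-nonNegative         zero    ny i = ℤ.≤-refl
geometric-nonNegative {y} (suc n) ny = +ᵖ-nonNegative {1ᵖ} {y *ᵖ geometric y n} 1ᵖ-nonNegative
  (*ᵖ-nonNegative {y} {geometric y n} ny (geometric-nonNegative n ny))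

Φ-nonNegative : ∀ {n} → IsPrimePower n → NonNegative (Φ n)
Φ-nonNegative (p , suc j , pr , _ , refl) = NonNegative-cong (R.sym (Φ[p^]≋Ψ pr (suc j)))
  (geometric-nonNegative p (X^-nonNegative (p ^ j)))

∏Φ-nonNegative : ∀ {ns} → All IsPrimePower ns → NonNegative (∏Φ ns)
∏Φ-nonNegative []                  = 1ᵖ-nonNegative
∏Φ-nonNegative {n ∷ ns} (pp ∷ pps) = *ᵖ-nonNegative {Φ n} {∏Φ ns} (Φ-nonNegative pp) (∏Φ-nonNegative pps)

0<* : ∀ {i j} → 0ℤ < i → 0ℤ < j → 0ℤ < i * j
0<* {i} {j} 0<i 0<j = ℤ.*-monoʳ-<-pos j {{ℤ.positive 0<j}} 0<i

0<ε-∏Φ : ∀ {ns} → All IsPrimePower ns → 0ℤ < ε (∏Φ ns)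
0<ε-∏Φ []                             = ℤ.+<+ (s≤s z≤n)
0<ε-∏Φ {n ∷ ns} (pp@(p , _ , pr , _) ∷ pps) = subst (0ℤ <_) (sym (ε-* (Φ n) (∏Φ ns)))
  (0<* (subst (0ℤ <_) (sym (ε-Φ pp)) (ℤ.+<+ (ℕ.>-nonZero⁻¹ p {{prime⇒nonZero pr}}))) (0<ε-∏Φ pps))

infix 4 _≤ᶜ_
_≤ᶜ_ : Poly → Poly → Set
p ≤ᶜ q = ∀ i → coeff p i ≤ coeff q i

-- Greedy choice: coefficients are taken whole, from the constant term on, until the rest of c fits
-- into one coefficient; all later ones are 0.
truncate : ∀ p c → NonNegative p → 0ℤ ≤ c → c ≤ ε p → ∃ λ q → NonNegative q × q ≤ᶜ p × ε q ≡ c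
truncate []      c _  0≤c c≤0 = [] , (λ i → ℤ.≤-refl) , (λ i → ℤ.≤-refl) , ℤ.≤-antisym 0≤c c≤0
truncate (a ∷ p) c np 0≤c c≤  with c ℤ.≤? a
... | yes c≤a = [ c ] , (λ { zero → 0≤c ; (suc i) → ℤ.≤-refl }) , (λ { zero → c≤a ; (suc i) → np (suc i) }) , ε-[] c
... | no  c≰a =
  let q , nq , q≤p , e = truncate p (c ℤ.- a) (np ∘ suc) (ℤ.i≤j⇒0≤j-i (ℤ.<⇒≤ (ℤ.≰⇒> c≰a)))
        (subst (c ℤ.- a ≤_) (cancel a (ε p)) (ℤ.+-monoˡ-≤ (- a) (subst (c ≤_) (ε-∷ a p) c≤)))
  in a ∷ q , (λ { zero → np 0 ; (suc i) → nq i }) , (λ { zero → ℤ.≤-refl ; (suc i) → q≤p i }) ,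
     trans (ε-∷ a q) (trans (cong (λ e → a + e) e) (restore a c))
  where
  cancel : ∀ a e → a + e ℤ.- a ≡ e
  cancel = ℤSolver.solve-∀
  restore : ∀ a c → a + (c ℤ.- a) ≡ c
  restore = ℤSolver.solve-∀

≤ᶜ-*ᵖ : ∀ {p q r} → p ≤ᶜ q → NonNegative r → p *ᵖ r ≤ᶜ q *ᵖ r
≤ᶜ-*ᵖ {p} {q} {r} p≤q nr i = ℤ.0≤i-j⇒j≤i (subst (0ℤ ≤_) (trans (at (expand p q r) i) (coeff-- (q *ᵖ r) (p *ᵖ r) i))
  (*ᵖ-nonNegative {q +ᵖ -ᵖ p} {r} (λ j → subst (0ℤ ≤_) (sym (coeff-- q p j)) (ℤ.i≤j⇒0≤j-i (p≤q j))) nr i))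
  where
  expand : ∀ p q r → (q +ᵖ -ᵖ p) *ᵖ r ≋ q *ᵖ r +ᵖ -ᵖ (p *ᵖ r)
  expand = solve-∀ polySolverRing
  coeff-- : ∀ a b i → coeff (a +ᵖ -ᵖ b) i ≡ coeff a i ℤ.- coeff b i
  coeff-- a b i = trans (coeff-+ᵖ a (-ᵖ b) i) (cong (λ c → coeff a i + c) (coeff--ᵖ b i))

0≤i≤1⇒0or1 : ∀ {i} → 0ℤ ≤ i → i ≤ 1ℤ → i ≡ 0ℤ ⊎ i ≡ 1ℤ
0≤i≤1⇒0or1 {+ 0} _ _ = inj₁ refl
0≤i≤1⇒0or1 {+ 1} _ _ = inj₂ refl
0≤i≤1⇒0or1 {+ suc (suc i)} _ (+≤+ (s≤s ()))

geometric≋applyUpTo-1 : ∀ n → geometric X n ≋ applyUpTo (const 1ℤ) n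
geometric≋applyUpTo-1 n = R.sym (R.trans (applyUpTo-const 1ℤ n) (R.*-identityˡ (geometric X n)))

coeff-geometric≤1 : ∀ n i → coeff (geometric X n) i ≤ 1ℤ
coeff-geometric≤1 n i with i ℕ.<? n
... | yes i<n = ℤ.≤-reflexive (trans (at (geometric≋applyUpTo-1 n) i) (coeff-applyUpTo-< (const 1ℤ) n i i<n))
... | no  i≮n = ℤ.≤-trans (ℤ.≤-reflexive (trans (at (geometric≋applyUpTo-1 n) i)
                  (applyUpTo-vanishes (const 1ℤ) n i (ℕ.≮⇒≥ i≮n)))) (+≤+ z≤n)

geometric-vanishes : ∀ n → VanishesFrom n (geometric X n)
geometric-vanishes n i n≤i = trans (at (geometric≋applyUpTo-1 n) i) (applyUpTo-vanishes (const 1ℤ) n i n≤i)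

applyUpTo-coeff : ∀ n p → VanishesFrom n p → applyUpTo (coeff p) n ≋ p
applyUpTo-coeff n p v = mk≋ λ i → go i
  where
  go : ∀ i → coeff (applyUpTo (coeff p) n) i ≡ coeff p i
  go i with i ℕ.<? n
  ... | yes i<n = coeff-applyUpTo-< (coeff p) n i i<n
  ... | no  i≮n = trans (applyUpTo-vanishes (coeff p) n i (ℕ.≮⇒≥ i≮n)) (sym (v i (ℕ.≮⇒≥ i≮n)))

-- Both claims for an abstract factorisation N = M D E

module Tilings {k : ℕ} (u : Fin (suc k) → ℤ) (m : ℤ) where

  private
    P = suc k
    N = geometric X P
  open Cyclic k using (multitiling⇒mod; mod⇒multitiling)

  ε-N : ε N ≡ + P
  ε-N = ε-geometric X P refl

  X^P-1 : ∀ s → s *ᵖ X^n-1 P ≋ s *ᵖ X-1 *ᵖ N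
  X^P-1 s = R.trans (R.*-congˡ {s} (R.sym (geometric-* X P))) (swap s N X-1)
    where
    swap : ∀ a b c → a *ᵖ (b *ᵖ c) ≋ a *ᵖ c *ᵖ b
    swap = solve-∀ polySolverRing

  -- A multiple κ (x ^ P - 1) equals κ (x - 1) N, so it joins m N to give s = m + κ (x - 1), and the
  -- added term vanishes at 1.
  multiple-of-N : ∀ v → IsMultitiling u m v → ∃ λ s → Q v *ᵖ Q u ≋ s *ᵖ N × ε s ≡ m
  multiple-of-N v tiles = let (κ , e) = multitiling⇒mod u {m} {v} tiles in [ m ] +ᵖ κ *ᵖ X-1 ,
    R.trans e (R.trans (R.+-congˡ {[ m ] *ᵖ N} (X^P-1 κ)) (R.sym (R.distribʳ N [ m ] (κ *ᵖ X-1)))) ,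
    (begin
    ε ([ m ] +ᵖ κ *ᵖ X-1)       ≡⟨ ε-+ [ m ] (κ *ᵖ X-1) ⟩
    ε [ m ] + ε (κ *ᵖ X-1)      ≡⟨ cong₂ _+_ (ε-[] m) (ε-* κ X-1) ⟩
    m + ε κ * 0ℤ                ≡⟨ cong (λ e → m + e) (ℤ.*-zeroʳ (ε κ)) ⟩
    m + 0ℤ                      ≡⟨ ℤ.+-identityʳ m ⟩
    m                           ∎)
    where open ≡-Reasoning

  -- Replacing s by its remainder s(1) modulo x - 1 changes s N by a multiple of x ^ P - 1. The
  -- polynomial V need not be reduced.
  fromMultiple : ∀ v V s → V ≋ Q v ⟨mod X^n-1 P ⟩ → V *ᵖ Q u ≋ s *ᵖ N → ε s ≡ m → IsMultitiling u m v
  fromMultiple v V s (κ , e) VQ≋ εs≡m =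
    let s′ , f = divide-by-X-1 s in
    mod⇒multitiling u {m} {v} (mod-trans
      (mod-sym (κ *ᵖ Q u , R.trans (R.*-congʳ {Q u} e) (expand (Q v) κ (X^n-1 P) (Q u))))
      (s′ , (begin
      V *ᵖ Q u                              ≈⟨ VQ≋ ⟩
      s *ᵖ N                                ≈⟨ R.*-congʳ {N} f ⟩
      (s′ *ᵖ X-1 +ᵖ [ ε s ]) *ᵖ N           ≡⟨ cong (λ c → (s′ *ᵖ X-1 +ᵖ [ c ]) *ᵖ N) εs≡m ⟩
      (s′ *ᵖ X-1 +ᵖ [ m ]) *ᵖ N             ≈⟨ distribute (s′ *ᵖ X-1) [ m ] N ⟩
      [ m ] *ᵖ N +ᵖ s′ *ᵖ X-1 *ᵖ N          ≈⟨ R.+-congˡ {[ m ] *ᵖ N} (X^P-1 s′) ⟨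
      [ m ] *ᵖ N +ᵖ s′ *ᵖ X^n-1 P           ∎)))
    where
    open ≋-Reasoning
    expand : ∀ q k x u → (q +ᵖ k *ᵖ x) *ᵖ u ≋ q *ᵖ u +ᵖ k *ᵖ u *ᵖ x
    expand = solve-∀ polySolverRing
    distribute : ∀ a b n → (a +ᵖ b) *ᵖ n ≋ b *ᵖ n +ᵖ a *ᵖ n
    distribute = solve-∀ polySolverRing

  module _ (D E M : Poly) (M*D*E≋N : M *ᵖ (D *ᵖ E) ≋ N) (ε-M : ε M ≡ 1ℤ) (D∣Q : D ∣ₚ Q u) where

    εDεE : ε D * ε E ≡ + P
    εDεE = begin
      ε D * ε E              ≡⟨ ε-* D E ⟨
      ε (D *ᵖ E)             ≡⟨ ℤ.*-identityˡ (ε (D *ᵖ E)) ⟨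
      1ℤ * ε (D *ᵖ E)        ≡⟨ cong (_* ε (D *ᵖ E)) ε-M ⟨
      ε M * ε (D *ᵖ E)       ≡⟨ ε-* M (D *ᵖ E) ⟨
      ε (M *ᵖ (D *ᵖ E))      ≡⟨ ε-cong M*D*E≋N ⟩
      ε N                    ≡⟨ ε-N ⟩
      + P                    ∎
      where open ≡-Reasoning

    -- The equation Q_v Q_u = s N is evaluated at 1 with Q_v = w E and N(1) = D(1) E(1); the nonzero
    -- factor E(1) then cancels.
    divisible : ∀ v → IsMultitiling u m v → E ∣ₚ Q v → ε (Q u) ∣ m * ε D
    divisible v tiles (w , wE≋Qv) = let s , e , εs≡m = multiple-of-N v tiles in
      ℤ∣.divides (ε w) (ℤ.*-cancelʳ-≡ (m * ε D) (ε w * ε (Q u)) (ε E) {{ℤ.≢-nonZero εE≢0}} (begin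
        m * ε D * ε E               ≡⟨ ℤ.*-assoc m (ε D) (ε E) ⟩
        m * (ε D * ε E)             ≡⟨ cong₂ _*_ (sym εs≡m) (trans εDεE (sym ε-N)) ⟩
        ε s * ε N                   ≡⟨ ε-* s N ⟨
        ε (s *ᵖ N)                  ≡⟨ ε-cong (R.trans (R.sym e) (R.*-congʳ {Q u} (R.sym wE≋Qv))) ⟩
        ε (w *ᵖ E *ᵖ Q u)           ≡⟨ trans (ε-* (w *ᵖ E) (Q u)) (cong (_* ε (Q u)) (ε-* w E)) ⟩
        ε w * ε E * ε (Q u)         ≡⟨ swap (ε w) (ε E) (ε (Q u)) ⟩
        ε w * ε (Q u) * ε E         ∎))
      where
      open ≡-Reasoning
      swap : ∀ a b c → a * b * c ≡ a * c * b
      swap = ℤSolver.solve-∀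
      εE≢0 : ε E ≢ 0ℤ
      εE≢0 εE≡0 with () ← trans (sym εDεE) (trans (cong (ε D *_) εE≡0) (ℤ.*-zeroʳ (ε D)))

    -- Common core of both existence claims: K is the constant c for multitilings and a truncation
    -- of D with value c at 1 for tilings. The multiplier of N is K R, where Q_u = R D.
    complement : ∀ v K → K *ᵖ (M *ᵖ E) ≋ Q v ⟨mod X^n-1 P ⟩ → m * ε D ≡ ε K * ε (Q u) → IsMultitiling u m v
    complement v K V≋ mD≡CQ = let R , RD≋Q = D∣Q in fromMultiple v (K *ᵖ (M *ᵖ E)) (K *ᵖ R) V≋
      (R.trans (R.*-congˡ {K *ᵖ (M *ᵖ E)} (R.sym RD≋Q)) (R.trans (regroup K M E R D) (R.*-congˡ {K *ᵖ R} M*D*E≋N)))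
      (ℤ.*-cancelʳ-≡ (ε (K *ᵖ R)) m (ε D) {{ℤ.≢-nonZero εD≢0}} (begin
        ε (K *ᵖ R) * ε D        ≡⟨ cong (_* ε D) (ε-* K R) ⟩
        ε K * ε R * ε D         ≡⟨ ℤ.*-assoc (ε K) (ε R) (ε D) ⟩
        ε K * (ε R * ε D)       ≡⟨ cong (ε K *_) (trans (sym (ε-* R D)) (ε-cong RD≋Q)) ⟩
        ε K * ε (Q u)           ≡⟨ mD≡CQ ⟨
        m * ε D                 ∎))
      where
      open ≡-Reasoning
      regroup : ∀ K M E R D → K *ᵖ (M *ᵖ E) *ᵖ (R *ᵖ D) ≋ K *ᵖ R *ᵖ (M *ᵖ (D *ᵖ E))
      regroup = solve-∀ polySolverRing
      εD≢0 : ε D ≢ 0ℤ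
      εD≢0 εD≡0 with () ← trans (sym εDεE) (cong (_* ε E) εD≡0)

    multitiling : ε (Q u) ∣ m * ε D → ∃ λ v → IsMultitiling u m v
    multitiling (ℤ∣.divides c mD≡cQ) =
      let w , e = residue P ([ c ] *ᵖ (M *ᵖ E)) in
      w ∘ toℕ , complement (w ∘ toℕ) [ c ] (mod-trans e (mod-reflexive (R.reflexive (sym (tabulate-toℕ w P)))))
        (trans mD≡cQ (cong (_* ε (Q u)) (sym (ε-[] c))))

  module _ (D E : Poly) (D*E≋N : D *ᵖ E ≋ N) (D∣Q : D ∣ₚ Q u)
    (D≥0 : NonNegative D) (E≥0 : NonNegative E) (0<εD : 0ℤ < ε D) where

    tiling : ε (Q u) ∣ m * ε D → 0ℤ < m → m ≤ ε (Q u) → ∃ λ v → IsTiling u m v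
    tiling (ℤ∣.divides c mD≡cQ) 0<m m≤Q =
      let K , K≥0 , K≤D , εK≡c = truncate D c D≥0 0≤c c≤εD
          V = K *ᵖ E
          V≥0 = *ᵖ-nonNegative {K} {E} K≥0 E≥0
          V≤N = λ i → ℤ.≤-trans (≤ᶜ-*ᵖ {K} {D} {E} K≤D E≥0 i) (ℤ.≤-reflexive (at D*E≋N i))
          vanishes : VanishesFrom P V
          -- Squeezed between 0 and the coefficients of N, V already has degree below P; no
          -- wrap-around modulo x ^ P - 1 can add coefficients together.
          vanishes = λ i P≤i → ℤ.≤-antisym (ℤ.≤-trans (V≤N i) (ℤ.≤-reflexive (geometric-vanishes P i P≤i))) (V≥0 i)
      in coeff V ∘ toℕ ,
         complement D E 1ᵖ (R.trans (R.*-identityˡ (D *ᵖ E)) D*E≋N) refl D∣Q (coeff V ∘ toℕ) K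
           (mod-reflexive (R.trans (R.*-congˡ {K} (R.*-identityˡ E))
             (R.trans (R.sym (applyUpTo-coeff P V vanishes)) (R.reflexive (sym (tabulate-toℕ (coeff V) P))))))
           (trans mD≡cQ (cong (_* ε (Q u)) (sym εK≡c))) ,
         λ h → 0≤i≤1⇒0or1 (V≥0 (toℕ h)) (ℤ.≤-trans (V≤N (toℕ h)) (coeff-geometric≤1 P (toℕ h)))
      where
      instance
        Q-positive : ℤ.Positive (ε (Q u))
        Q-positive = ℤ.positive (ℤ.<-≤-trans 0<m m≤Q)
      0≤c : 0ℤ ≤ c
      0≤c = ℤ.*-cancelʳ-≤-pos 0ℤ c (ε (Q u)) (subst (0ℤ ≤_) mD≡cQ (ℤ.<⇒≤ (0<* 0<m 0<εD)))
      c≤εD : c ≤ ε D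
      c≤εD = ℤ.*-cancelʳ-≤-pos c (ε D) (ε (Q u)) (subst₂ _≤_ mD≡cQ (ℤ.*-comm (ε (Q u)) (ε D))
        (ℤ.*-monoʳ-≤-nonNeg (ε D) {{ℤ.nonNegative (ℤ.<⇒≤ 0<εD)}} m≤Q))

ascending-filter-upTo : ∀ {A : ℕ → Set} (a? : Decidable A) n → AllPairs ℕ._<_ (filter a? (upTo n))
ascending-filter-upTo a? n = AllPairs.filter⁺ a? (AllPairs.applyUpTo⁺₁ id n λ i<j _ → i<j)

-- The factorisation of N belonging to a tile

module _ {k : ℕ} (u : Fin (suc k) → ℤ) where

  private
    P = suc k
    N = geometric X P

  Index Coindex : ℕ → Set
  Index n   = n ℕ∣.∣ P × Φ n ∣ᵖ Q u × IsPrimePower n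
  Coindex n = PrimePowerDivisor P n × ¬ (Φ n ∣ᵖ Q u)

  coindex? : Decidable Coindex
  coindex? n = primePowerDivisor? P n ×-dec ¬? (Φ n ∣ᵖ? Q u)

  divisors indices coindices : List ℕ
  divisors  = filter (primePowerDivisor? P) (upTo (suc P))
  indices   = filter (d̃-index? u) (upTo (suc P))
  coindices = filter coindex? (upTo (suc P))

  divisors-PP : All (PrimePowerDivisor P) divisors
  divisors-PP = all-filter (primePowerDivisor? P) (upTo (suc P))

  indices-Index : All Index indices
  indices-Index = all-filter (d̃-index? u) (upTo (suc P))

  coindices-Coindex : All Coindex coindices
  coindices-Coindex = all-filter coindex? (upTo (suc P))

  D E : Poly
  D = d̃ u
  E = ∏Φ coindices

  D*E≋∏Φ : D *ᵖ E ≋ ∏Φ divisors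
  D*E≋∏Φ = ∏Φ-filter-⊎ (d̃-index? u) coindex? (primePowerDivisor? P) decide
    (λ (d , _ , pp) → d , pp) proj₁ (λ (_ , Φ∣Q , _) (_ , Φ∤Q) → Φ∤Q Φ∣Q) (upTo (suc P))
    where
    decide : ∀ {n} → PrimePowerDivisor P n → Index n ⊎ Coindex n
    decide {n} (d , pp) with Φ n ∣ᵖ? Q u
    ... | yes Φ∣Q = inj₁ (d , Φ∣Q , pp)
    ... | no  Φ∤Q = inj₂ ((d , pp) , Φ∤Q)

  D∣Q : D ∣ₚ Q u
  D∣Q = ∏Φ-∣ (ascending-filter-upTo (d̃-index? u) (suc P)) (All.map (proj₂ ∘ proj₂) indices-Index)
    (All.map (λ (_ , (r , e) , _) → r , mk≋ e) indices-Index)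

  E∣cofactor : ∀ v s → Q v *ᵖ Q u ≋ s *ᵖ N → E ∣ₚ Q {P} v
  E∣cofactor v s e = ∏Φ-∣ (ascending-filter-upTo coindex? (suc P)) (All.map (proj₂ ∘ proj₁) coindices-Coindex)
    (All.map Φ∣ coindices-Coindex)
    where
    Φ∣ : ∀ {n} → Coindex n → Φ n ∣ₚ Q v
    Φ∣ {n} ((d , pp) , Φ∤Q) with Φ-prime pp (Q v) (Q u) (∣ₚ-trans (Φ∣geometric pp d) (s , R.sym e))
    ... | inj₁ Φ∣Qv       = Φ∣Qv
    ... | inj₂ (r , rΦ≋Q) = ⊥-elim (Φ∤Q (r , at rΦ≋Q))

  -- The value is known on the list built along the prime factorisation of P, which is a permutation
  -- of the filtered one.
  ε-∏Φ-divisors : ε (∏Φ divisors) ≡ + P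
  ε-∏Φ-divisors with factorise P
  ... | record { factors = ps ; isFactorisation = P≡∏ps ; factorsPrime = prs } with ∏Φ-primePowerDivisors ps prs
  ...   | ns , lists , e = trans
    (ε-cong (∏Φ-↭ (primePowerDivisors-↭ (filter-primePowerDivisors P) (subst (λ m → ListsPrimePowerDivisors m ns) (sym P≡∏ps) lists))))
    (trans e (cong +_ (sym P≡∏ps)))

  ∏Φ-divisors∣N : ∏Φ divisors ∣ₚ N
  ∏Φ-divisors∣N = ∏Φ-∣ (ascending-filter-upTo (primePowerDivisor? P) (suc P)) (All.map proj₂ divisors-PP)
    (All.map (λ (d , pp) → Φ∣geometric pp d) divisors-PP)

  -- M is the product of the Φₙ over the divisors n > 1 of P that are not prime
  -- powers, but only its value at 1 is needed.
  M : Poly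
  M = proj₁ ∏Φ-divisors∣N

  M*D*E≋N : M *ᵖ (D *ᵖ E) ≋ N
  M*D*E≋N = R.trans (R.*-congˡ {M} D*E≋∏Φ) (proj₂ ∏Φ-divisors∣N)

  ε-M : ε M ≡ 1ℤ
  ε-M = ℤ.*-cancelʳ-≡ (ε M) 1ℤ (+ P) (begin
    ε M * + P                 ≡⟨ cong (ε M *_) ε-∏Φ-divisors ⟨
    ε M * ε (∏Φ divisors)     ≡⟨ ε-* M (∏Φ divisors) ⟨
    ε (M *ᵖ ∏Φ divisors)      ≡⟨ ε-cong (proj₂ ∏Φ-divisors∣N) ⟩
    ε N                       ≡⟨ ε-geometric X P refl ⟩
    + P                       ≡⟨ ℤ.*-identityˡ (+ P) ⟨
    1ℤ * + P                  ∎)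
    where open ≡-Reasoning

  -- For P = p ^ t the prime power divisors are p, ..., p ^ t, and the product of their Φₙ with x -
  -- 1 telescopes to x ^ P - 1.
  primePower⇒D*E≋N : IsPrimePower P → D *ᵖ E ≋ N
  primePower⇒D*E≋N (p , t , pr , _ , P≡p^t) = *ᵖ-cancelʳ X-1≢0 (begin
    D *ᵖ E *ᵖ X-1                     ≈⟨ R.*-congʳ {X-1} (R.trans D*E≋∏Φ (∏Φ-↭ (primePowerDivisors-↭
                                           (filter-primePowerDivisors P)
                                           (subst (λ m → ListsPrimePowerDivisors m (primePowers pr t)) (sym P≡p^t) (primePowers-divisors pr t))))) ⟩
    ∏Φ (primePowers pr t) *ᵖ X-1      ≈⟨ ∏Φ-primePowers pr t ⟩
    X^n-1 (p ^ t)                     ≡⟨ cong X^n-1 P≡p^t ⟨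
    X^n-1 P                           ≈⟨ geometric-* X P ⟨
    N *ᵖ X-1                          ∎)
    where open ≋-Reasoning

lemma1 : (P : ℕ) .{{_ : NonZero P}} (u : Fin P → ℤ) (m : ℤ) → m ≢ 0ℤ →
    ((∃ λ v → IsMultitiling u m v) ⇔ (eval (Q u) 1ℤ ∣ m * eval (d̃ u) 1ℤ))
    × (eval (Q u) 1ℤ ∣ m * eval (d̃ u) 1ℤ → IsPrimePower P →
    0ℤ < m → m ≤ eval (Q u) 1ℤ → ∃ λ v → IsTiling u m v)
lemma1 (suc k) u m _ =
  mk⇔ (λ (v , tiles) → let s , e , _ = multiple-of-N v tiles in
         divisible (D u) (E u) (M u) (M*D*E≋N u) (ε-M u) (D∣Q u) v tiles (E∣cofactor u v s e))
      (multitiling (D u) (E u) (M u) (M*D*E≋N u) (ε-M u) (D∣Q u)) ,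
  λ Q∣mD pp → tiling (D u) (E u) (primePower⇒D*E≋N u pp) (D∣Q u)
    (∏Φ-nonNegative index-PP) (∏Φ-nonNegative (All.map (proj₂ ∘ proj₁) (coindices-Coindex u)))
    (0<ε-∏Φ index-PP) Q∣mD
  where
  open Tilings u m
  index-PP : All IsPrimePower (indices u)
  index-PP = All.map (proj₂ ∘ proj₂) (indices-Index u)
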